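{- Let $n>k\ge 2$, and let $G$ be a $k$-connected graph on $n$ vertices. (a) We have \[ mc_k(G)\le e(G)-\left\lceil\frac{k\binom{n}{2}-e(G)}{n-2}\right\rceil+1. \] (b) If $e(G)=\lceil\frac{kn}{2}\rceil$, then $mc_k(G)=1$.
   Context: All graphs are finite, simple and undirected. A graph is $k$-connected if it has at least $k+1$ vertices and remains connected after deleting any at most $k-1$ vertices. Paths are called disjoint if they are internally vertex-disjoint. An edge-coloured path is monochromatic if all its edges have the same colour. For a $k$-connected graph $G$, an edge-colouring is monochromatic $k$-connected if any two vertices are connected by $k$ disjoint monochromatic paths; $mc_k(G)$ is the maximum number of colours in a monochromatic $k$-connected colouring of $G$. -}

module Defs where

open import Data.Fin using (Fin; _<?_)
open import Data.Fin.Subset using (Subset; ∣_∣; _∉_)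
open import Data.List using (List; _∷_; _++_; [_]; length; filter; allFin; cartesianProduct)
open import Data.List.Relation.Unary.All using (All)
open import Data.List.Relation.Unary.Linked using (Linked)
open import Data.List.Relation.Unary.Unique.Propositional using (Unique)
open import Data.List.Relation.Binary.Disjoint.Propositional using (Disjoint)
open import Data.Nat using (ℕ; _∸_; _≤_; _<_; NonZero; >-nonZero)
open import Data.Nat.Properties using (≤-<-trans; m<n⇒0<n∸m)
open import Data.Product using (Σ-syntax; ∃-syntax; _×_; _,_)
open import Level using (0ℓ)
open import Relation.Binary using (Rel; Symmetric; Decidable)
open import Relation.Binary.PropositionalEquality using (_≡_; _≢_)
open import Relation.Nullary using (¬_)
open import Relation.Nullary.Decidable using (_×-dec_)

record Graph (n : ℕ) : Set₁ where
  field
    _~_      : Rel (Fin n) 0ℓ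
    _~?_     : Decidable _~_
    ~-sym    : Symmetric _~_
    ~-irrefl : ∀ {v} → ¬ (v ~ v)

module _ {n : ℕ} (G : Graph n) where
  open Graph G

  -- Each edge is listed once, as the pair (u , v) of its ends with u < v.
  edges : List (Fin n × Fin n)
  edges = filter (λ { (u , v) → (u <? v) ×-dec (u ~? v) })
                 (cartesianProduct (allFin n) (allFin n))

  e : ℕ
  e = length edges

  -- Uniqueness of the vertices forces u ≢ v; `inner` is empty exactly when
  -- the path is the single edge uv.
  record Path (u v : Fin n) : Set where
    field
      inner : List (Fin n)

    vertices : List (Fin n)
    vertices = u ∷ inner ++ [ v ]

    field
      linked : Linked _~_ vertices
      unique : Unique vertices

  open Path

  -- Deleting S leaves a connected graph.
  ConnectedWithout : Subset n → Set
  ConnectedWithout S = ∀ u v → u ∉ S → v ∉ S → u ≢ v →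
    Σ[ P ∈ Path u v ] All (_∉ S) (vertices P)

  KConnected : ℕ → Set
  KConnected k = k < n × (∀ (S : Subset n) → ∣ S ∣ < k → ConnectedWithout S)

  -- An edge-colouring with exactly m colours.  `colour-edge` says both that
  -- the colour does not depend on the orientation of the edge and (applied
  -- twice) that it does not depend on the proof of adjacency.
  record Colouring (m : ℕ) : Set where
    field
      colour      : ∀ {u v} → u ~ v → Fin m
      colour-edge : ∀ {u v} (p : u ~ v) (q : v ~ u) → colour p ≡ colour q
      all-used    : ∀ c → ∃[ u ] ∃[ v ] Σ[ p ∈ u ~ v ] colour p ≡ c

  Monochromatic : ∀ {m} → Colouring m → ∀ {u v} → Path u v → Set
  Monochromatic C P =
    ∃[ c ] Linked (λ x y → Σ[ p ∈ x ~ y ] Colouring.colour C p ≡ c) (vertices P)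

  -- The paths must also be distinct: the single edge uv has no inner vertex,
  -- so it would otherwise be disjoint from itself.
  DisjointPaths : ∀ {k u v} → (Fin k → Path u v) → Set
  DisjointPaths Ps = ∀ i j → i ≢ j →
    inner (Ps i) ≢ inner (Ps j) × Disjoint (inner (Ps i)) (inner (Ps j))

  MonochromaticConnected : ℕ → ∀ {m} → Colouring m → Set
  MonochromaticConnected k C = ∀ u v → u ≢ v →
    Σ[ Ps ∈ (Fin k → Path u v) ] DisjointPaths Ps × (∀ i → Monochromatic C (Ps i))

  -- mc_k(G) = m, as a relation: the maximum is attained and equals m.
  IsMc : ℕ → ℕ → Set
  IsMc k m =
    (Σ[ C ∈ Colouring m ] MonochromaticConnected k C) ×
    (∀ m′ (C : Colouring m′) → MonochromaticConnected k C → m′ ≤ m)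

n∸2-nonZero : ∀ {n k} → 2 ≤ k → k < n → NonZero (n ∸ 2)
n∸2-nonZero 2≤k k<n = >-nonZero (m<n⇒0<n∸m (≤-<-trans 2≤k k<n))

{-# OPTIONS --safe #-}

-- For an ordered pair of vertices u, v the k chosen paths use k edges at u and k edges
-- at v, so over all pairs exactly Σ (deg u + deg v - 2k) edge-ends remain unused, and
-- both bounds follow once every colour but one is charged 4(n - 2) of them. A colour
-- with a component C that is not spanning leaves unused, for u ∈ C and v ∉ C, all its
-- edges at u; as C has at least |C| - 1 edges, this gives
-- 4(|C| - 1)(n - |C|) ≥ 4(n - 2). Two spanning connected colours, one of them the
-- exempt colour c₀, meet at each w in cherries u - w - v with edges of both
-- colours. Such a w lies inside at most one path from u to v, which has a single colour,
-- so an edge of the cherry is unused; there are at least 3n - 4 of these cherries.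
--
-- That one colour suffices for a k-connected graph is Menger's theorem.
module Submission where

open import Defs
open import Data.Empty using (⊥; ⊥-elim)
open import Data.Fin using (Fin; zero; suc; punchOut; inject≤; _≟_; _<?_)
open import Data.Fin.Properties as Fin using (any?; all?; ¬∀⟶∃¬; injective⇒≤; punchOut-injective; inject≤-injective)
open import Data.Fin.Subset as Subset using (Subset; ∣_∣; inside; outside)
open import Data.Fin.Subset.Properties using (∣⊥∣≡0; ∉⊥)
open import Data.List using (List; []; _∷_; _++_; [_]; length; lookup; filter; allFin; cartesianProduct; tabulate; map)
open import Data.List.Membership.Propositional using (_∈_; _∉_)
open import Data.List.Membership.Propositional.Properties using (∈-lookup; ∈-allFin; ∈-filter⁺; ∈-filter⁻; ∈-cartesianProduct⁺; ∈-++⁺ˡ; ∈-++⁺ʳ)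
open import Data.List.Properties using (filter-++; length-++; length-filter; map-tabulate)
open import Data.List.Relation.Binary.Disjoint.Propositional using (Disjoint)
open import Data.List.Relation.Binary.Subset.Propositional using (_⊆_)
open import Data.List.Relation.Unary.All as All using (All; []; _∷_)
open import Data.List.Relation.Unary.All.Properties as All using (¬Any⇒All¬)
open import Data.List.Relation.Unary.AllPairs using ([]; _∷_)
open import Data.List.Relation.Unary.Any as Any using (here; there)
open import Data.List.Relation.Unary.Any.Properties using (lookup-index)
open import Data.List.Relation.Unary.Linked as Linked using (Linked; []; [-]; _∷_)
open import Data.List.Relation.Unary.Unique.Propositional using (Unique)
open import Data.List.Relation.Unary.Unique.Propositional.Properties as Unique using (allFin⁺; filter⁺; Unique[x∷xs]⇒x∉xs)
open import Data.Nat using (ℕ; zero; suc; _+_; _*_; _∸_; _≤_; _≰_; _<_; _≤?_; z≤n; s≤s; ⌈_/2⌉)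
open import Data.Nat.Combinatorics using (_C_; nCk+nC[k+1]≡[n+1]C[k+1]; nC1≡n)
open import Data.Nat.Properties hiding (_≟_; _<?_; _≤?_)
open import Algebra.Properties.Semiring.Sum +-*-semiring using (sum; sum-syntax; sum-cong-≗; ∑-distrib-+; ∑-comm; *-distribˡ-sum; *-distribʳ-sum)
open import Data.Nat.Tactic.RingSolver using (solve-∀)
open import Data.Product using (∃; ∃-syntax; Σ-syntax; _×_; _,_; proj₁; proj₂)
open import Data.Rational.Unnormalised using (_/_; ceiling)
open import Data.Sum using (_⊎_; inj₁; inj₂; [_,_]′; map₁)
open import Data.Vec using ([]; _∷_; _[_]≔_)
open import Data.Vec.Properties using ([]≔-updates; []≔-minimal; lookup⇒[]=; []=⇒lookup; lookup∘update′)
open import Function using (_∘_; id)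
open import Function.Definitions using (Injective)
open import Relation.Binary using (Symmetric; Decidable; tri<; tri≈; tri>)
open import Relation.Binary.PropositionalEquality using (_≡_; _≢_; refl; sym; trans; cong; cong₂; subst; module ≡-Reasoning)
open import Relation.Nullary using (¬_; Dec; yes; no; contradiction; ¬?)
open import Relation.Nullary.Decidable using (_×-dec_; _⊎-dec_)
import Relation.Unary as U

-- Menger's theorem

injective⇒surjective : ∀ {k} (f : Fin k → Fin k) → Injective _≡_ _≡_ f →
  ∀ j → ∃[ i ] f i ≡ j
injective⇒surjective {suc k} f inj j with any? (λ i → f i ≟ j)
... | yes hit  = hit
... | no  miss = contradiction (injective⇒≤ {f = g} g-inj) 1+n≰n
  where
  g : Fin (suc k) → Fin k
  g i = punchOut {i = j} {j = f i} (λ eq → miss (i , sym eq))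
  g-inj : Injective _≡_ _≡_ g
  g-inj {i} {i′} eq =
    inj (punchOut-injective (λ p → miss (i , sym p)) (λ p → miss (i′ , sym p)) eq)

Unique⇒lookup-injective : ∀ {A : Set} {xs : List A} → Unique xs → Injective _≡_ _≡_ (lookup xs)
Unique⇒lookup-injective (_  ∷ _) {zero}  {zero}  _  = refl
Unique⇒lookup-injective u@(_ ∷ _) {zero} {suc j} eq =
  contradiction (subst (_∈ _) (sym eq) (∈-lookup j)) (Unique[x∷xs]⇒x∉xs u)
Unique⇒lookup-injective u@(_ ∷ _) {suc i} {zero} eq =
  contradiction (subst (_∈ _) eq (∈-lookup i)) (Unique[x∷xs]⇒x∉xs u)
Unique⇒lookup-injective (_  ∷ u) {suc i} {suc j} eq = cong suc (Unique⇒lookup-injective u eq)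

index-injective : ∀ {A : Set} {k} {xs : List A} (f : Fin k → A) (f∈ : ∀ i → f i ∈ xs) →
  Injective _≡_ _≡_ f → Injective _≡_ _≡_ (λ i → Any.index (f∈ i))
index-injective {xs = xs} f f∈ inj {i} {j} eq =
  inj (trans (lookup-index (f∈ i)) (trans (cong (lookup xs) eq) (sym (lookup-index (f∈ j)))))

-- The pigeonhole principle in the form that sorts the ends of a linkage: an injection into the
-- entries of a list of the same length hits every position, so it can be reordered to follow the
-- list.
injective⇒enumerates : ∀ {A : Set} {xs : List A} (f : Fin (length xs) → A) → (∀ i → f i ∈ xs) →
  Injective _≡_ _≡_ f →
  Σ[ π ∈ (Fin (length xs) → Fin (length xs)) ] Injective _≡_ _≡_ π × (∀ r → f (π r) ≡ lookup xs r)
injective⇒enumerates {xs = xs} f f∈ inj = proj₁ ∘ surj , π-inj ,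
  λ r → trans (lookup-index (f∈ _)) (cong (lookup xs) (proj₂ (surj r)))
  where
  surj = injective⇒surjective _ (index-injective f f∈ inj)
  π-inj : Injective _≡_ _≡_ (proj₁ ∘ surj)
  π-inj {r} {s} eq =
    trans (sym (proj₂ (surj r))) (trans (cong (λ i → Any.index (f∈ i)) eq) (proj₂ (surj s)))

module Menger {n : ℕ} where

  V : Set
  V = Fin n

  open import Data.List.Membership.DecPropositional (_≟_ {n}) using (_∈?_)

  -- The list index holds the vertices visited, both ends included.
  data Walk (es : List (V × V)) : V → List V → V → Set where
    stop : ∀ {a} → Walk es a (a ∷ []) a
    step : ∀ {a b l c} → (a , b) ∈ es → Walk es b l c → Walk es a (a ∷ l) c

  private variable
    es   : List (V × V)
    a b c x y z : V
    l l₁ l₂ : List V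
    A B S : List V
    k : ℕ

  walk-start : Walk es a l b → a ∈ l
  walk-start stop       = here refl
  walk-start (step _ _) = here refl

  walk-end : Walk es a l b → b ∈ l
  walk-end stop       = here refl
  walk-end (step _ w) = there (walk-end w)

  weaken : ∀ {e} → Walk es a l b → Walk (e ∷ es) a l b
  weaken stop       = stop
  weaken (step p w) = step (there p) (weaken w)

  -- The last component says that a simple walk, cut at z, keeps its end only if z is that end. It
  -- and its mirror image in `suffix` let `cross` locate the vertex where two linkages meet.
  prefix : Walk es a l b → z ∈ l →
    ∃[ l₁ ] Walk es a l₁ z × l₁ ⊆ l × (Unique l → b ∈ l₁ → z ≡ b)
  prefix stop (here refl) = _ , stop , id , λ _ _ → refl
  prefix (step p w) (here refl) =
    _ , stop , (λ { (here refl) → here refl }) , λ { _ (here refl) → refl }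
  prefix (step p w) (there z∈) with l₁ , w₁ , sub , end ← prefix w z∈ =
    _ , step p w₁ , (λ { (here refl) → here refl ; (there q) → there (sub q) }) ,
    λ { u (here refl) → contradiction (walk-end w) (Unique[x∷xs]⇒x∉xs u)
      ; (_ ∷ u) (there q) → end u q }

  suffix : Walk es a l b → z ∈ l →
    ∃[ l₂ ] Walk es z l₂ b × l₂ ⊆ l × (Unique l → a ∈ l₂ → z ≡ a)
  suffix stop (here refl) = _ , stop , id , λ _ _ → refl
  suffix (step p w) (here refl) = _ , step p w , id , λ _ _ → refl
  suffix (step p w) (there z∈) with l₂ , w₂ , sub , _ ← suffix w z∈ =
    l₂ , w₂ , there ∘ sub , λ u q → contradiction (sub q) (Unique[x∷xs]⇒x∉xs u)

  join : Walk es a l₁ b → Walk es b l₂ c →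
    ∃[ l ] Walk es a l c × (∀ {v} → v ∈ l → v ∈ l₁ ⊎ v ∈ l₂)
  join stop w = _ , w , inj₂
  join (step p v) w with l , vw , sub ← join v w =
    _ , step p vw , λ { (here refl) → inj₁ (here refl)
                      ; (there q) → map₁ there (sub q) }

  simplify : Walk es a l b → ∃[ l′ ] Walk es a l′ b × Unique l′ × l′ ⊆ l
  simplify stop = _ , stop , All.[] ∷ [] , id
  simplify (step {a = a} p w) with l′ , w′ , u , sub ← simplify w | a ∈? l′
  ... | no a∉ = _ , step p w′ , ¬Any⇒All¬ _ a∉ ∷ u ,
        λ { (here refl) → here refl ; (there q) → there (sub q) }
  ... | yes a∈ = shortcut w′ u sub a∈
    where
    shortcut : ∀ {a b c l l′} → Walk es b l′ c → Unique l′ → l′ ⊆ l → a ∈ l′ →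
      ∃[ l″ ] Walk es a l″ c × Unique l″ × l″ ⊆ (a ∷ l)
    shortcut stop u sub (here refl) = _ , stop , u , there ∘ sub
    shortcut (step p w) u sub (here refl) = _ , step p w , u , there ∘ sub
    shortcut (step p w) (_ ∷ u) sub (there q) = shortcut w u (sub ∘ there) q

  first-use : Walk ((x , y) ∷ es) a l b →
    Walk es a l b ⊎ (∃[ l₁ ] Walk es a l₁ x × l₁ ⊆ l)
  first-use stop = inj₁ stop
  first-use (step (here refl) w) = inj₂ (_ , stop , λ { (here refl) → here refl })
  first-use (step (there p) w) with first-use w
  ... | inj₁ w′ = inj₁ (step p w′)
  ... | inj₂ (l₁ , w₁ , sub) = inj₂ (_ , step p w₁ ,
        λ { (here refl) → here refl ; (there q) → there (sub q) })

  last-use : Walk ((x , y) ∷ es) a l b →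
    Walk es a l b ⊎ (∃[ l₂ ] Walk es y l₂ b × l₂ ⊆ l)
  last-use stop = inj₁ stop
  last-use (step p w) with last-use w
  last-use (step p w) | inj₂ (l₂ , w₂ , sub) = inj₂ (l₂ , w₂ , there ∘ sub)
  last-use (step (here refl) w) | inj₁ w′ = inj₂ (_ , w′ , there)
  last-use (step (there p) w)   | inj₁ w′ = inj₁ (step p w′)

  Separates : List (V × V) → (A B S : List V) → Set
  Separates es A B S = ∀ {a b l} → a ∈ A → b ∈ B → Walk es a l b → ∃[ s ] s ∈ S × s ∈ l

  record Linkage (es : List (V × V)) (A B : List V) (k : ℕ) : Set where
    field
      {src tgt} : Fin k → V
      {verts}   : Fin k → List V
      walk      : ∀ i → Walk es (src i) (verts i) (tgt i)
      src∈      : ∀ i → src i ∈ A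
      tgt∈      : ∀ i → tgt i ∈ B
      simple    : ∀ i → Unique (verts i)
      disjoint  : ∀ {i j v} → v ∈ verts i → v ∈ verts j → i ≡ j

  open Linkage

  src-injective : (P : Linkage es A B k) → Injective _≡_ _≡_ (src P)
  src-injective P {i} {j} eq =
    disjoint P (walk-start (walk P i)) (subst (_∈ verts P j) (sym eq) (walk-start (walk P j)))

  tgt-injective : (P : Linkage es A B k) → Injective _≡_ _≡_ (tgt P)
  tgt-injective P {i} {j} eq =
    disjoint P (walk-end (walk P i)) (subst (_∈ verts P j) (sym eq) (walk-end (walk P j)))

  reindex : ∀ {k′} → Linkage es A B k → (π : Fin k′ → Fin k) → Injective _≡_ _≡_ π →
    Linkage es A B k′
  reindex P π π-inj = record
    { walk = walk P ∘ π ; src∈ = src∈ P ∘ π ; tgt∈ = tgt∈ P ∘ π ; simple = simple P ∘ π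
    ; disjoint = λ p q → π-inj (disjoint P p q) }

  module Compose
    (S-sep : Separates es A B S)
    (P : Linkage es A (x ∷ S) (suc (length S))) (P-tgt : ∀ r → tgt P r ≡ lookup (x ∷ S) r)
    (Q : Linkage es (y ∷ S) B (suc (length S))) (Q-src : ∀ r → src Q r ≡ lookup (y ∷ S) r)
    where

    S∈P : ∀ q → lookup S q ∈ verts P (suc q)
    S∈P q = subst (_∈ verts P (suc q)) (P-tgt (suc q)) (walk-end (walk P (suc q)))

    S∈Q : ∀ q → lookup S q ∈ verts Q (suc q)
    S∈Q q = subst (_∈ verts Q (suc q)) (Q-src (suc q)) (walk-start (walk Q (suc q)))

    -- The walk through a common vertex z meets S, and by disjointness only at
    -- the end of its P-part or at the start of its Q-part; hence z itself is in S.
    cross : ∀ {r t z} → z ∈ verts P r → z ∈ verts Q t → r ≡ t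
    cross {r} {t} {z} z∈P z∈Q
      with l₁ , w₁ , sub₁ , end₁ ← prefix (walk P r) z∈P
         | l₂ , w₂ , sub₂ , end₂ ← suffix (walk Q t) z∈Q
      with l , w , sub ← join w₁ w₂
      with s , s∈S , s∈l ← S-sep (src∈ P r) (tgt∈ Q t) w
      with Any.index s∈S | lookup-index s∈S
    ... | q | refl with sub s∈l
    ...   | inj₁ s∈l₁ with refl ← disjoint P (sub₁ s∈l₁) (S∈P q) =
            disjoint Q (S∈Q q) (subst (_∈ verts Q t) z≡s z∈Q)
      where
      z≡s : z ≡ lookup S q
      z≡s = trans (end₁ (simple P r) (subst (_∈ l₁) (sym (P-tgt (suc q))) s∈l₁)) (P-tgt (suc q))
    ...   | inj₂ s∈l₂ with refl ← disjoint Q (sub₂ s∈l₂) (S∈Q q) =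
            disjoint P (subst (_∈ verts P r) z≡s z∈P) (S∈P q)
      where
      z≡s : z ≡ lookup S q
      z≡s = trans (end₂ (simple Q t) (subst (_∈ l₂) (sym (Q-src (suc q))) s∈l₂)) (Q-src (suc q))

    glue : ∀ r → ∃[ l ] Walk ((x , y) ∷ es) (src P r) l (tgt Q r) ×
      (∀ {v} → v ∈ l → v ∈ verts P r ⊎ v ∈ verts Q r)
    glue zero
      with l , w , sub ← join (subst (Walk ((x , y) ∷ es) _ _) (P-tgt zero) (weaken (walk P zero)))
             (step (here refl) (subst (λ a → Walk ((x , y) ∷ es) a _ _) (Q-src zero) (weaken (walk Q zero)))) =
      l , w , sub′ ∘ sub
      where
      sub′ : ∀ {v} → v ∈ verts P zero ⊎ v ∈ (x ∷ verts Q zero) → v ∈ verts P zero ⊎ v ∈ verts Q zero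
      sub′ (inj₁ p) = inj₁ p
      sub′ (inj₂ (here refl)) = inj₁ (subst (_∈ verts P zero) (P-tgt zero) (walk-end (walk P zero)))
      sub′ (inj₂ (there q)) = inj₂ q
    glue (suc q) = join (weaken (walk P (suc q)))
      (subst (λ a → Walk _ a _ _) (trans (Q-src (suc q)) (sym (P-tgt (suc q)))) (weaken (walk Q (suc q))))

    joined : ∀ r → ∃[ l ] Walk ((x , y) ∷ es) (src P r) l (tgt Q r) × Unique l ×
      (∀ {v} → v ∈ l → v ∈ verts P r ⊎ v ∈ verts Q r)
    joined r with l , w , sub ← glue r with l′ , w′ , u , sub′ ← simplify w =
      l′ , w′ , u , sub ∘ sub′

    composite : Linkage ((x , y) ∷ es) A B (suc (length S))
    composite = record
      { walk = λ r → proj₁ (proj₂ (joined r))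
      ; src∈ = src∈ P
      ; tgt∈ = tgt∈ Q
      ; simple = λ r → proj₁ (proj₂ (proj₂ (joined r)))
      ; disjoint = λ {r} {t} p q → disj (proj₂ (proj₂ (proj₂ (joined r))) p) (proj₂ (proj₂ (proj₂ (joined t))) q)
      }
      where
      disj : ∀ {r t v} → v ∈ verts P r ⊎ v ∈ verts Q r → v ∈ verts P t ⊎ v ∈ verts Q t → r ≡ t
      disj (inj₁ p) (inj₁ q) = disjoint P p q
      disj (inj₁ p) (inj₂ q) = cross p q
      disj (inj₂ p) (inj₁ q) = sym (cross q p)
      disj (inj₂ p) (inj₂ q) = disjoint Q p q

  -- The walks of `P` have k distinct ends in x ∷ S, whose length is at most k. So k is
  -- `suc (length S)`, the ends exhaust x ∷ S, and likewise for the starts of `Q`; sorted alike, the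
  -- two linkages fit together, with x matched to y by the new arc.
  compose : length S < k → Separates es A B S →
    Linkage es A (x ∷ S) k → Linkage es (y ∷ S) B k → Linkage ((x , y) ∷ es) A B k
  compose S<k sep P Q
    with refl ← ≤-antisym (injective⇒≤ (index-injective (tgt P) (tgt∈ P) (tgt-injective P))) S<k =
    let π , π-inj , P-tgt = injective⇒enumerates (tgt P) (tgt∈ P) (tgt-injective P)
        ρ , ρ-inj , Q-src = injective⇒enumerates (src Q) (src∈ Q) (src-injective Q)
    in Compose.composite sep (reindex P π π-inj) P-tgt (reindex Q ρ ρ-inj) Q-src

  _∩_ : List V → List V → List V
  A ∩ B = filter (λ v → (v ∈? A) ×-dec (v ∈? B)) (allFin n)

  ∈-∩⁺ : a ∈ A → a ∈ B → a ∈ A ∩ B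
  ∈-∩⁺ a∈A a∈B = ∈-filter⁺ _ (∈-allFin _) (a∈A , a∈B)

  ∈-∩⁻ : a ∈ A ∩ B → a ∈ A × a ∈ B
  ∈-∩⁻ = proj₂ ∘ ∈-filter⁻ _ {xs = allFin n}

  -- Göring's proof: if S separates A from B once the edge xy is removed, then linking A to
  -- S ∪ {x} and S ∪ {y} to B without that edge gives the two halves of a linkage through S and xy.
  menger : ∀ es A B k → Linkage es A B k ⊎ (∃[ S ] length S < k × Separates es A B S)
  menger [] A B k with k ≤? length (A ∩ B)
  ... | yes k≤ = inj₁ record
    { walk = λ _ → stop
    ; src∈ = λ i → proj₁ (common i)
    ; tgt∈ = λ i → proj₂ (common i)
    ; simple = λ _ → All.[] ∷ []
    ; disjoint = λ { (here refl) (here eq) → inject≤-injective k≤ k≤ _ _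
        (Unique⇒lookup-injective (filter⁺ _ (allFin⁺ n)) eq) }
    }
    where
    common : ∀ i → lookup (A ∩ B) (inject≤ i k≤) ∈ A × lookup (A ∩ B) (inject≤ i k≤) ∈ B
    common i = ∈-∩⁻ {A = A} {B} (∈-lookup (inject≤ i k≤))
  ... | no k≰ = inj₂ (A ∩ B , ≰⇒> k≰ , λ { a∈ b∈ stop → _ , ∈-∩⁺ a∈ b∈ , here refl })
  menger ((x , y) ∷ es) A B k with menger es A B k
  ... | inj₁ L = inj₁ record
    { walk = weaken ∘ walk L ; src∈ = src∈ L ; tgt∈ = tgt∈ L ; simple = simple L ; disjoint = disjoint L }
  ... | inj₂ (S , S<k , S-sep) with menger es A (x ∷ S) k | menger es (y ∷ S) B k
  ...   | inj₁ P | inj₁ Q = inj₁ (compose S<k S-sep P Q)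
  ...   | inj₂ (T , T<k , T-sep) | _ = inj₂ (T , T<k , sep)
    where
    sep : Separates ((x , y) ∷ es) A B T
    -- A walk that uses xy reaches x before its first use of it, and one that avoids xy meets S.
    -- Either way some initial part leads from A to x ∷ S within `es`, and so meets T. The other
    -- case is the mirror image, with final parts starting in y ∷ S.
    sep a∈ b∈ w with first-use w
    ... | inj₂ (_ , w₁ , sub) with t , t∈ , t∈l ← T-sep a∈ (here refl) w₁ = t , t∈ , sub t∈l
    ... | inj₁ w′ with s , s∈S , s∈l ← S-sep a∈ b∈ w′
        with _ , w₁ , sub , _ ← prefix w′ s∈l
        with t , t∈ , t∈l ← T-sep a∈ (there s∈S) w₁ = t , t∈ , sub t∈l
  ...   | inj₁ _ | inj₂ (T , T<k , T-sep) = inj₂ (T , T<k , sep)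
    where
    sep : Separates ((x , y) ∷ es) A B T
    sep a∈ b∈ w with last-use w
    ... | inj₂ (_ , w₂ , sub) with t , t∈ , t∈l ← T-sep (here refl) b∈ w₂ = t , t∈ , sub t∈l
    ... | inj₁ w′ with s , s∈S , s∈l ← S-sep a∈ b∈ w′
        with _ , w₂ , sub , _ ← suffix w′ s∈l
        with t , t∈ , t∈l ← T-sep (there s∈S) b∈ w₂ = t , t∈ , sub t∈l

-- Disjoint paths in a k-connected graph

fromList : ∀ {n} → List (Fin n) → Subset n
fromList []       = Subset.⊥
fromList (x ∷ xs) = fromList xs [ x ]≔ inside

∣fromList∣≤length : ∀ {n} (xs : List (Fin n)) → ∣ fromList xs ∣ ≤ length xs
∣fromList∣≤length {n} [] = ≤-reflexive (∣⊥∣≡0 n)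
∣fromList∣≤length (x ∷ xs) = ≤-trans (∣insert∣≤ (fromList xs) x) (s≤s (∣fromList∣≤length xs))
  where
  ∣insert∣≤ : ∀ {n} (S : Subset n) x → ∣ S [ x ]≔ inside ∣ ≤ suc ∣ S ∣
  ∣insert∣≤ (inside  ∷ S) zero    = n≤1+n _
  ∣insert∣≤ (outside ∷ S) zero    = ≤-refl
  ∣insert∣≤ (inside  ∷ S) (suc x) = s≤s (∣insert∣≤ S x)
  ∣insert∣≤ (outside ∷ S) (suc x) = ∣insert∣≤ S x

∈-fromList⁺ : ∀ {n} {x : Fin n} {xs} → x ∈ xs → x Subset.∈ fromList xs
∈-fromList⁺ {xs = y ∷ xs} (here refl) = []≔-updates (fromList xs) y
∈-fromList⁺ {x = x} {xs = y ∷ xs} (there x∈) with x ≟ y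
... | yes refl = []≔-updates (fromList xs) y
... | no x≢y   = []≔-minimal (fromList xs) x y x≢y (∈-fromList⁺ x∈)

∈-fromList⁻ : ∀ {n} {x : Fin n} xs → x Subset.∈ fromList xs → x ∈ xs
∈-fromList⁻ [] p = contradiction p ∉⊥
∈-fromList⁻ {x = x} (y ∷ xs) p with x ≟ y
... | yes refl = here refl
... | no x≢y   = there (∈-fromList⁻ xs (lookup⇒[]= x _
        (trans (sym (lookup∘update′ x≢y (fromList xs) inside)) ([]=⇒lookup p))))

last∉ : ∀ {A : Set} (xs : List A) {y} → Unique (xs ++ [ y ]) → y ∉ xs
last∉ (x ∷ xs) u (here refl) = Unique.Unique[x∷xs]⇒x∉xs u (∈-++⁺ʳ xs (here refl))
last∉ (x ∷ xs) (_ ∷ u) (there p) = last∉ xs u p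

∃∉ : ∀ {n} (xs : List (Fin n)) → length xs < n → ∃[ x ] x ∉ xs
∃∉ {n} xs short = ¬∀⟶∃¬ n (_∈ xs) (_∈? xs) λ all →
  <⇒≱ short (injective⇒≤ (index-injective id all id))
  where open import Data.List.Membership.DecPropositional (_≟_ {n}) using (_∈?_)

module _ {n : ℕ} (G : Graph n) where
  open Graph G
  open Path
  open Menger {n}

  avoiding : ∀ {k} → KConnected G k → (T : List (Fin n)) → length T < k →
    ∀ {u v} → u ∉ T → v ∉ T → u ≢ v → Σ[ P ∈ Path G u v ] (∀ {t} → t ∈ T → t ∉ vertices P)
  avoiding (_ , conn) T T<k u∉ v∉ u≢v
    with P , out ← conn (fromList T) (≤-<-trans (∣fromList∣≤length T) T<k) _ _
                     (u∉ ∘ ∈-fromList⁻ T) (v∉ ∘ ∈-fromList⁻ T) u≢v =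
    P , λ t∈T t∈P → All.lookup out t∈P (∈-fromList⁺ t∈T)

  -- Menger's theorem for sets of vertices is applied to G without u and v, between the
  -- neighbourhoods of u and v there. Fully disjoint walks then become internally disjoint paths
  -- from u to v, and the edge uv, if present, is not among them.
  module Interior (u v : Fin n) (u≢v : u ≢ v) where

    Inner : Fin n → Set
    Inner x = x ≢ u × x ≢ v

    inner? : ∀ x → Dec (Inner x)
    inner? x = ¬? (x ≟ u) ×-dec ¬? (x ≟ v)

    innerEdge? : (p : Fin n × Fin n) →
      Dec (Inner (proj₁ p) × Inner (proj₂ p) × proj₁ p ~ proj₂ p)
    innerEdge? (x , y) = inner? x ×-dec inner? y ×-dec x ~? y

    es : List (Fin n × Fin n)
    es = filter innerEdge? (cartesianProduct (allFin n) (allFin n))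

    N : Fin n → List (Fin n)
    N x = filter (λ y → inner? y ×-dec x ~? y) (allFin n)

    ∈es⁺ : ∀ {x y} → Inner x → Inner y → x ~ y → (x , y) ∈ es
    ∈es⁺ ix iy x~y = ∈-filter⁺ innerEdge? (∈-cartesianProduct⁺ (∈-allFin _) (∈-allFin _)) (ix , iy , x~y)

    ∈es⁻ : ∀ {x y} → (x , y) ∈ es → Inner x × Inner y × x ~ y
    ∈es⁻ = proj₂ ∘ ∈-filter⁻ innerEdge? {xs = cartesianProduct (allFin n) (allFin n)}

    ∈N⁺ : ∀ {x y} → Inner y → x ~ y → y ∈ N x
    ∈N⁺ {x} iy x~y = ∈-filter⁺ (λ y → inner? y ×-dec x ~? y) (∈-allFin _) (iy , x~y)

    ∈N⁻ : ∀ {x y} → y ∈ N x → Inner y × x ~ y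
    ∈N⁻ {x} = proj₂ ∘ ∈-filter⁻ (λ y → inner? y ×-dec x ~? y) {xs = allFin n}

    walk⇒inner : ∀ {a l b} → Inner a → Walk es a l b → All Inner l
    walk⇒inner ia stop = ia ∷ []
    walk⇒inner ia (step p w) = ia ∷ walk⇒inner (proj₁ (proj₂ (∈es⁻ p))) w

    walk⇒linked : ∀ {x a l b} → x ~ a → Walk es a l b → b ~ v → Linked _~_ (x ∷ l ++ [ v ])
    walk⇒linked p stop q = p ∷ q ∷ [-]
    walk⇒linked p (step e w) q = p ∷ walk⇒linked (proj₂ (proj₂ (∈es⁻ e))) w q

    walk⇒path : ∀ {a l b} → a ∈ N u → b ∈ N v → Walk es a l b → Unique l →
      Σ[ P ∈ Path G u v ] inner P ≡ l
    walk⇒path {l = l} a∈ b∈ w uniq = record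
      { inner  = l
      ; linked = walk⇒linked (proj₂ (∈N⁻ a∈)) w (~-sym (proj₂ (∈N⁻ b∈)))
      ; unique = All.++⁺ (All.map (λ i → proj₁ i ∘ sym) inn) (u≢v ∷ [])
               ∷ Unique.++⁺ uniq ([] ∷ []) λ { (p , here refl) → proj₂ (All.lookup inn p) refl }
      } , refl
      where
      inn : All Inner l
      inn = walk⇒inner (proj₁ (∈N⁻ a∈)) w

    linked⇒walk : ∀ {x y} xs → Linked _~_ (x ∷ xs ++ [ y ]) → (∀ {z} → z ∈ x ∷ xs → Inner z) →
      ∃[ b ] Walk es x (x ∷ xs) b × b ~ y
    linked⇒walk [] (p ∷ _) _ = _ , stop , p
    linked⇒walk (z ∷ xs) (p ∷ ps) inn with b , w , q ← linked⇒walk xs ps (inn ∘ there) =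
      b , step (∈es⁺ (inn (here refl)) (inn (there (here refl))) p) w , q

    arrive : ∀ {w} (Q : Path G w v) → u ∉ vertices Q →
      ∃[ b ] ∃[ l ] b ∈ N v × Walk es w l b × l ⊆ vertices Q
    arrive {w} record { inner = xs ; linked = ps ; unique = uniq } u∉ =
      let b , walk , q = linked⇒walk xs ps inn in
      b , _ , ∈N⁺ (inn (walk-end walk)) (~-sym q) , walk , ∈-++⁺ˡ
      where
      inn : ∀ {z} → z ∈ w ∷ xs → Inner z
      inn z∈ = (λ { refl → u∉ (∈-++⁺ˡ z∈) }) , λ { refl → last∉ (w ∷ xs) uniq z∈ }

    leave : ∀ {w} (P : Path G u w) → v ∉ vertices P → Inner w →
      ∃[ a ] ∃[ l ] a ∈ N u × Walk es a l w × l ⊆ vertices P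
    leave record { inner = [] ; linked = p ∷ _ } _ iw =
      _ , _ , ∈N⁺ iw p , stop , there
    leave {w} record { inner = x ∷ xs ; linked = p ∷ ps ; unique = u≢ ∷ _ } v∉ iw
      = let b , walk , q = linked⇒walk xs ps inn
            l , walk′ , sub = join walk (step (∈es⁺ (inn (walk-end walk)) iw q) stop) in
      x , l , ∈N⁺ (inn (here refl)) p , walk′ ,
      λ z∈ → there ([ ∈-++⁺ˡ , (λ { (here refl) → ∈-++⁺ˡ (walk-end walk)
                                   ; (there (here refl)) → ∈-++⁺ʳ (x ∷ xs) (here refl) }) ]′ (sub z∈))
      where
      inn : ∀ {z} → z ∈ x ∷ xs → Inner z
      inn z∈ = (λ { refl → All.lookup u≢ (∈-++⁺ˡ z∈) refl }) , λ { refl → v∉ (there (∈-++⁺ˡ z∈)) }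

    cross : (P : Path G u v) → ¬ u ~ v →
      ∃[ a ] ∃[ b ] ∃[ l ] a ∈ N u × b ∈ N v × Walk es a l b × l ⊆ vertices P
    cross record { inner = [] ; linked = p ∷ _ } u≁v = contradiction p u≁v
    cross record { inner = x ∷ xs ; linked = p ∷ ps ; unique = u∉@(u≢x ∷ _) ∷ uniq } _
      with b , l , b∈ , walk , sub ← arrive record { inner = xs ; linked = ps ; unique = uniq }
                                       (λ u∈ → All.lookup u∉ u∈ refl) =
      x , b , l , ∈N⁺ (u≢x ∘ sym , λ { refl → last∉ (x ∷ xs) uniq (here refl) }) p , b∈ , walk , there ∘ sub

    module _ {T : List (Fin n)} (sep : Separates es (N u) (N v) T) where

      -- The walks contain inner vertices only, so dropping u and v from T keeps it separating. It
      -- also makes T deletable in G while u and v stay, as connectedness without a set requires.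
      T′ : List (Fin n)
      T′ = filter inner? T

      T′-inner : ∀ {x} → x ∈ T′ → Inner x
      T′-inner = proj₂ ∘ ∈-filter⁻ inner? {xs = T}

      no-avoiding-walk : ∀ {a l b} → a ∈ N u → b ∈ N v → Walk es a l b → (∀ {t} → t ∈ T′ → t ∉ l) → ⊥
      no-avoiding-walk a∈ b∈ w out with s , s∈T , s∈l ← sep a∈ b∈ w =
        out (∈-filter⁺ inner? s∈T (All.lookup (walk⇒inner (proj₁ (∈N⁻ a∈)) w) s∈l)) s∈l

      nonadjacent-separator : ∀ {k} → KConnected G k → ¬ u ~ v → k ≤ length T
      nonadjacent-separator {k} conn u≁v with k ≤? length T
      ... | yes k≤ = k≤
      ... | no k≰
        with P , out ← avoiding conn T′ (≤-<-trans (length-filter inner? T) (≰⇒> k≰))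
                         (λ p → proj₁ (T′-inner p) refl) (λ p → proj₂ (T′-inner p) refl) u≢v
        with _ , _ , _ , a∈ , b∈ , w , sub ← cross P u≁v =
        ⊥-elim (no-avoiding-walk a∈ b∈ w λ t∈ t∈l → out t∈ (sub t∈l))

      -- The edge uv survives the removal of T, so it is blocked by removing also v or u:
      -- this leaves walks from N u to some w, and from w to N v.
      adjacent-separator : ∀ {k} → KConnected G (suc k) → k ≤ length T
      adjacent-separator {k} conn@(k<n , _) with k ≤? length T
      ... | yes k≤ = k≤
      ... | no k≰
        -- A further vertex exists because 2 + |T| ≤ k + 1 < n.
        with w , w∉ ← ∃∉ (u ∷ v ∷ T) (≤-<-trans (s≤s (≰⇒> k≰)) k<n) =
        ⊥-elim contra
        where
        T′<k : length T′ < k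
        T′<k = ≤-<-trans (length-filter inner? T) (≰⇒> k≰)
        iw : Inner w
        iw = (λ { refl → w∉ (here refl) }) , λ { refl → w∉ (there (here refl)) }
        w∉T′ : w ∉ T′
        w∉T′ = w∉ ∘ there ∘ there ∘ proj₁ ∘ ∈-filter⁻ inner? {xs = T}
        contra : ⊥
        contra
          with P , outP ← avoiding conn (v ∷ T′) (s≤s T′<k)
                 (λ { (here eq) → u≢v eq ; (there p) → proj₁ (T′-inner p) refl })
                 (λ { (here eq) → proj₂ iw eq ; (there p) → w∉T′ p }) (proj₁ iw ∘ sym)
             | Q , outQ ← avoiding conn (u ∷ T′) (s≤s T′<k)
                 (λ { (here eq) → proj₁ iw eq ; (there p) → w∉T′ p })
                 (λ { (here eq) → u≢v (sym eq) ; (there p) → proj₂ (T′-inner p) refl }) (proj₂ iw)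
          with _ , _ , a∈ , wP , subP ← leave P (outP (here refl)) iw
             | _ , _ , b∈ , wQ , subQ ← arrive Q (outQ (here refl))
          with _ , w , sub ← join wP wQ =
          no-avoiding-walk a∈ b∈ w λ t∈ t∈l →
            [ outP (there t∈) ∘ subP , outQ (there t∈) ∘ subQ ]′ (sub t∈l)

  edgePath : ∀ {u v} → u ≢ v → u ~ v → Path G u v
  edgePath u≢v u~v = record { inner = [] ; linked = u~v ∷ [-] ; unique = (u≢v ∷ []) ∷ [] ∷ [] }

  KConnected⇒disjointPaths : ∀ {k} → KConnected G (suc k) → ∀ u v → u ≢ v →
    Σ[ Ps ∈ (Fin (suc k) → Path G u v) ] DisjointPaths G Ps
  KConnected⇒disjointPaths {k} conn u v u≢v = by-adjacency (u ~? v)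
    where
    open Interior u v u≢v
    open Linkage

    module FromLinkage {j} (L : Linkage es (N u) (N v) j) where
      path : ∀ i → Σ[ P ∈ Path G u v ] inner P ≡ verts L i
      path i = walk⇒path (src∈ L i) (tgt∈ L i) (walk L i) (simple L i)

      Ps : Fin j → Path G u v
      Ps = proj₁ ∘ path

      common⇒≡ : ∀ {i i′ x} → x ∈ inner (Ps i) → x ∈ inner (Ps i′) → i ≡ i′
      common⇒≡ {i} {i′} {x} p q =
        disjoint L (subst (x ∈_) (proj₂ (path i)) p) (subst (x ∈_) (proj₂ (path i′)) q)

      src∈inner : ∀ i → src L i ∈ inner (Ps i)
      src∈inner i = subst (_ ∈_) (sym (proj₂ (path i))) (walk-start (walk L i))

      disjointPs : DisjointPaths G Ps
      disjointPs i i′ i≢ = (λ eq → i≢ (common⇒≡ (src∈inner i) (subst (_ ∈_) eq (src∈inner i)))) ,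
        λ (p , q) → i≢ (common⇒≡ p q)

    by-adjacency : Dec (u ~ v) → Σ[ Ps ∈ (Fin (suc k) → Path G u v) ] DisjointPaths G Ps
    by-adjacency (no u≁v) with menger es (N u) (N v) (suc k)
    ... | inj₁ L = FromLinkage.Ps L , FromLinkage.disjointPs L
    ... | inj₂ (T , T<k , sep) = contradiction (nonadjacent-separator sep conn u≁v) (<⇒≱ T<k)
    by-adjacency (yes u~v) with menger es (N u) (N v) k
    ... | inj₂ (T , T<k , sep) = contradiction (adjacent-separator sep conn) (<⇒≱ T<k)
    ... | inj₁ L = Ps′ , disj
      where
      open FromLinkage L
      Ps′ : Fin (suc k) → Path G u v
      -- The linkage has one path too few here; the edge uv is the missing one, and it differs from
      -- the others because their interiors are nonempty.
      Ps′ zero    = edgePath u≢v u~v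
      Ps′ (suc i) = Ps i
      []≢ : ∀ i → [] ≢ inner (Ps i)
      []≢ i eq with () ← subst (src L i ∈_) (sym eq) (src∈inner i)
      disj : DisjointPaths G Ps′
      disj zero    zero     0≢0 = contradiction refl 0≢0
      disj zero    (suc i)  _ = []≢ i , λ { (() , _) }
      disj (suc i) zero     _ = []≢ i ∘ sym , λ { (_ , ()) }
      disj (suc i) (suc i′) i≢ = disjointPs i i′ (i≢ ∘ cong suc)

-- Sums and indicators

sum-mono-≤ : ∀ {n} {f g : Fin n → ℕ} → (∀ i → f i ≤ g i) → sum f ≤ sum g
sum-mono-≤ {zero}  _   = z≤n
sum-mono-≤ {suc n} f≤g = +-mono-≤ (f≤g zero) (sum-mono-≤ (f≤g ∘ suc))

sum-const : ∀ n c → ∑[ i < n ] c ≡ n * c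
sum-const zero    c = refl
sum-const (suc n) c = cong (c +_) (sum-const n c)

∑∑-distrib-+ : ∀ {m n} (f g : Fin m → Fin n → ℕ) → ∑[ a < m ] ∑[ b < n ] (f a b + g a b)
  ≡ ∑[ a < m ] ∑[ b < n ] f a b + ∑[ a < m ] ∑[ b < n ] g a b
∑∑-distrib-+ f g = trans (sum-cong-≗ (λ a → ∑-distrib-+ (f a) (g a)))
  (∑-distrib-+ (λ a → sum (f a)) (λ a → sum (g a)))

term≤sum : ∀ {n} (f : Fin n → ℕ) i → f i ≤ sum f
term≤sum f zero    = m≤m+n _ _
term≤sum f (suc i) = ≤-trans (term≤sum (f ∘ suc) i) (m≤n+m _ (f zero))

private variable
  P Q : Set

𝟙 : Dec P → ℕ
𝟙 (yes _) = 1
𝟙 (no  _) = 0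

𝟙≤1 : (p : Dec P) → 𝟙 p ≤ 1
𝟙≤1 (yes _) = ≤-refl
𝟙≤1 (no  _) = z≤n

𝟙-yes : (p : Dec P) → P → 𝟙 p ≡ 1
𝟙-yes (yes _) _ = refl
𝟙-yes (no ¬p) p = contradiction p ¬p

𝟙-no : (p : Dec P) → ¬ P → 𝟙 p ≡ 0
𝟙-no (yes p) ¬p = contradiction p ¬p
𝟙-no (no _)  _  = refl

𝟙-mono : (p : Dec P) (q : Dec Q) → (P → Q) → 𝟙 p ≤ 𝟙 q
𝟙-mono (yes p) q P⇒Q = ≤-reflexive (sym (𝟙-yes q (P⇒Q p)))
𝟙-mono (no _)  q _   = z≤n

𝟙-¬ : (p : Dec P) → 𝟙 p + 𝟙 (¬? p) ≡ 1
𝟙-¬ (yes _) = refl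
𝟙-¬ (no  _) = refl

𝟙-× : (p : Dec P) (q : Dec Q) → 𝟙 (p ×-dec q) ≡ 𝟙 p * 𝟙 q
𝟙-× (yes _) (yes _) = refl
𝟙-× (yes _) (no  _) = refl
𝟙-× (no  _) _       = refl

𝟙-⊎ : (p : Dec P) (q : Dec Q) → ¬ (P × Q) → 𝟙 (p ⊎-dec q) ≡ 𝟙 p + 𝟙 q
𝟙-⊎ (yes p) (yes q) excl = contradiction (p , q) excl
𝟙-⊎ (yes _) (no  _) _    = refl
𝟙-⊎ (no  _) (yes _) _    = refl
𝟙-⊎ (no  _) (no  _) _    = refl

𝟙-⊎-≤ : (p : Dec P) (q : Dec Q) → 𝟙 (p ⊎-dec q) ≤ 𝟙 p + 𝟙 q
𝟙-⊎-≤ (yes _) q       = m≤m+n 1 (𝟙 q)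
𝟙-⊎-≤ (no  _) (yes _) = ≤-refl
𝟙-⊎-≤ (no  _) (no  _) = ≤-refl

𝟙-+-≤ : {R : Set} (p : Dec P) (q : Dec Q) (r : Dec R) → ¬ (P × Q) → (P → R) → (Q → R) → 𝟙 p + 𝟙 q ≤ 𝟙 r
𝟙-+-≤ p q r excl P⇒R Q⇒R =
  ≤-trans (≤-reflexive (sym (𝟙-⊎ p q excl))) (𝟙-mono (p ⊎-dec q) r [ P⇒R , Q⇒R ]′)

sum-δ : ∀ {n} (j : Fin n) → ∑[ i < n ] 𝟙 (j ≟ i) ≡ 1
sum-δ {suc n} zero    = cong suc (trans (sum-cong-≗ {n} (λ i → 𝟙-no (zero ≟ suc i) λ ()))
                          (trans (sum-const n 0) (*-zeroʳ n)))
sum-δ {suc n} (suc j) = trans (sum-cong-≗ {n} (λ i → step i)) (sum-δ j)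
  where
  step : ∀ i → 𝟙 (suc j ≟ suc i) ≡ 𝟙 (j ≟ i)
  step i with j ≟ i
  ... | yes _ = refl
  ... | no  _ = refl

sum-exclusive-≤ : ∀ {n} {P : Fin n → Set} (P? : U.Decidable P) (q : Dec Q) →
  (∀ {i j} → P i → P j → i ≡ j) → (∀ {i} → P i → Q) → ∑[ i < n ] 𝟙 (P? i) ≤ 𝟙 q
sum-exclusive-≤ {n = n} P? q excl P⇒Q with any? P?
... | yes (j , pj) = begin
  ∑[ i < n ] 𝟙 (P? i)  ≤⟨ sum-mono-≤ (λ i → 𝟙-mono (P? i) (j ≟ i) (excl pj)) ⟩
  ∑[ i < n ] 𝟙 (j ≟ i) ≡⟨ sum-δ j ⟩
  1                    ≡⟨ 𝟙-yes q (P⇒Q pj) ⟨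
  𝟙 q                  ∎
  where open ≤-Reasoning
... | no ¬∃ = begin
  ∑[ i < n ] 𝟙 (P? i) ≡⟨ sum-cong-≗ (λ i → 𝟙-no (P? i) (λ pi → ¬∃ (i , pi))) ⟩
  ∑[ i < n ] 0        ≡⟨ sum-const n 0 ⟩
  n * 0               ≡⟨ *-zeroʳ n ⟩
  0                   ≤⟨ z≤n ⟩
  𝟙 q                 ∎
  where open ≤-Reasoning

size-image : ∀ {k n} (f : Fin k → Fin n) → Injective _≡_ _≡_ f →
  k ≤ ∑[ w < n ] 𝟙 (any? (λ i → f i ≟ w))
size-image {k} {n} f inj = begin
  k                                       ≡⟨ *-identityʳ k ⟨
  k * 1                                   ≡⟨ sum-const k 1 ⟨
  ∑[ i < k ] 1                            ≡⟨ sum-cong-≗ (λ i → sum-δ (f i)) ⟨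
  ∑[ i < k ] ∑[ w < n ] 𝟙 (f i ≟ w)       ≡⟨ ∑-comm {k} {n} (λ i w → 𝟙 (f i ≟ w)) ⟩
  ∑[ w < n ] ∑[ i < k ] 𝟙 (f i ≟ w)
    ≤⟨ sum-mono-≤ (λ w → sum-exclusive-≤ (λ i → f i ≟ w) (any? (λ i → f i ≟ w))
         (λ p q → inj (trans p (sym q))) (λ {i} p → i , p)) ⟩
  ∑[ w < n ] 𝟙 (any? (λ i → f i ≟ w))     ∎
  where open ≤-Reasoning

length-filter-tabulate : ∀ {A : Set} {P : A → Set} (P? : U.Decidable P) {n} (g : Fin n → A) →
  length (filter P? (tabulate g)) ≡ ∑[ i < n ] 𝟙 (P? (g i))
length-filter-tabulate P? {zero}  g = refl
length-filter-tabulate P? {suc n} g with P? (g zero)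
... | yes _ = cong suc (length-filter-tabulate P? (g ∘ suc))
... | no  _ = length-filter-tabulate P? (g ∘ suc)

length-filter-cartesianProduct : ∀ {m n} {P : Fin m × Fin n → Set} (P? : U.Decidable P) →
  length (filter P? (cartesianProduct (allFin m) (allFin n))) ≡ ∑[ u < m ] ∑[ v < n ] 𝟙 (P? (u , v))
length-filter-cartesianProduct {m} {n} P? = go id
  where
  open ≡-Reasoning
  go : ∀ {l} (g : Fin l → Fin m) → length (filter P? (cartesianProduct (tabulate g) (allFin n)))
    ≡ ∑[ u < l ] ∑[ v < n ] 𝟙 (P? (g u , v))
  go {zero}  g = refl
  go {suc l} g = begin
    length (filter P? (map (g zero ,_) (allFin n) ++ rest))
      ≡⟨ cong length (filter-++ P? (map (g zero ,_) (allFin n)) rest) ⟩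
    length (filter P? (map (g zero ,_) (allFin n)) ++ filter P? rest)
      ≡⟨ length-++ (filter P? (map (g zero ,_) (allFin n))) ⟩
    length (filter P? (map (g zero ,_) (allFin n))) + length (filter P? rest)
      ≡⟨ cong₂ _+_ (trans (cong (length ∘ filter P?) (map-tabulate id (g zero ,_)))
                     (length-filter-tabulate P? (g zero ,_))) (go (g ∘ suc)) ⟩
    ∑[ u < suc l ] ∑[ v < n ] 𝟙 (P? (g u , v)) ∎
    where rest = cartesianProduct (tabulate (g ∘ suc)) (allFin n)

-- Components of a symmetric relation

size : ∀ {n} {C : Fin n → Set} → U.Decidable C → ℕ
size {n} C? = ∑[ a < n ] 𝟙 (C? a)

size≤n : ∀ {n} {C : Fin n → Set} (C? : U.Decidable C) → size C? ≤ n
size≤n {n} C? = begin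
  size C?      ≤⟨ sum-mono-≤ (λ a → 𝟙≤1 (C? a)) ⟩
  ∑[ a < n ] 1 ≡⟨ sum-const n 1 ⟩
  n * 1        ≡⟨ *-identityʳ n ⟩
  n            ∎
  where open ≤-Reasoning

module _ {n : ℕ} {_~_ : Fin n → Fin n → Set} (_~?_ : Decidable _~_) where

  arcs : {C : Fin n → Set} → U.Decidable C → ℕ
  arcs C? = ∑[ a < n ] ∑[ b < n ] 𝟙 (C? a ×-dec C? b ×-dec a ~? b)

  -- All that is needed of connectedness is that C spans at least |C| - 1 edges, each of
  -- which `arcs` counts twice.
  record Tree (x : Fin n) : Set₁ where
    field
      {C}    : Fin n → Set
      C?     : U.Decidable C
      root   : C x
      nbr    : ∀ {a} → C a → ∃[ b ] a ~ b
      enough : 2 * size C? ≤ arcs C? + 2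

  open Tree

  Closed : ∀ {x} → Tree x → Set
  Closed t = ∀ {a b} → C t a → a ~ b → C t b

  module _ {x y w : Fin n} (t : Tree x) (Cy : C t y) (¬Cw : ¬ C t w) (y~w : y ~ w)
    (~-sym : Symmetric _~_) where

    private
      C⁺? : ∀ a → Dec (C t a ⊎ w ≡ a)
      C⁺? a = C? t a ⊎-dec w ≟ a

    size-extend : size C⁺? ≡ size (C? t) + 1
    size-extend = begin
      ∑[ a < n ] 𝟙 (C⁺? a)                 ≡⟨ sum-cong-≗ (λ a → 𝟙-⊎ (C? t a) (w ≟ a) λ { (c , refl) → ¬Cw c }) ⟩
      ∑[ a < n ] (𝟙 (C? t a) + 𝟙 (w ≟ a))  ≡⟨ ∑-distrib-+ (λ a → 𝟙 (C? t a)) (λ a → 𝟙 (w ≟ a)) ⟩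
      size (C? t) + ∑[ a < n ] 𝟙 (w ≟ a)   ≡⟨ cong (size (C? t) +_) (sum-δ w) ⟩
      size (C? t) + 1                      ∎
      where open ≡-Reasoning

    -- The arcs yw and wy are new because w lies outside the old vertex set, and they differ from
    -- each other because y lies inside it.
    arcs-extend : arcs (C? t) + 2 ≤ arcs C⁺?
    arcs-extend = begin
      arcs (C? t) + (1 + 1)
        ≤⟨ +-monoʳ-≤ (arcs (C? t)) (+-mono-≤ (one y w) (one w y)) ⟩
      arcs (C? t) + (∑[ a < n ] ∑[ b < n ] δ y w a b + ∑[ a < n ] ∑[ b < n ] δ w y a b)
        ≡⟨ cong (arcs (C? t) +_) (∑∑-distrib-+ (δ y w) (δ w y)) ⟨
      arcs (C? t) + ∑[ a < n ] ∑[ b < n ] (δ y w a b + δ w y a b)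
        ≡⟨ ∑∑-distrib-+ (λ a b → 𝟙 (old a b)) (λ a b → δ y w a b + δ w y a b) ⟨
      ∑[ a < n ] ∑[ b < n ] (𝟙 (old a b) + (δ y w a b + δ w y a b))
        ≤⟨ sum-mono-≤ (λ a → sum-mono-≤ (λ b → pointwise a b)) ⟩
      arcs C⁺? ∎
      where
      open ≤-Reasoning
      old : ∀ a b → Dec (C t a × C t b × a ~ b)
      old a b = C? t a ×-dec C? t b ×-dec a ~? b
      isArc : ∀ p q a b → Dec (p ≡ a × q ≡ b)
      isArc p q a b = p ≟ a ×-dec q ≟ b
      δ : Fin n → Fin n → Fin n → Fin n → ℕ
      δ p q a b = 𝟙 (isArc p q a b)
      one : ∀ p q → 1 ≤ ∑[ a < n ] ∑[ b < n ] δ p q a b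
      one p q = begin
        1                              ≡⟨ 𝟙-yes (isArc p q p q) (refl , refl) ⟨
        δ p q p q                      ≤⟨ term≤sum (δ p q p) q ⟩
        ∑[ b < n ] δ p q p b           ≤⟨ term≤sum (λ a → ∑[ b < n ] δ p q a b) p ⟩
        ∑[ a < n ] ∑[ b < n ] δ p q a b ∎
      pointwise : ∀ a b → 𝟙 (old a b) + (δ y w a b + δ w y a b)
        ≤ 𝟙 (C⁺? a ×-dec C⁺? b ×-dec a ~? b)
      pointwise a b = begin
        𝟙 (old a b) + (δ y w a b + δ w y a b)
          ≡⟨ cong (𝟙 (old a b) +_) (𝟙-⊎ (isArc y w a b) (isArc w y a b)
               λ { ((refl , _) , (refl , _)) → ¬Cw Cy }) ⟨
        𝟙 (old a b) + 𝟙 (isArc y w a b ⊎-dec isArc w y a b)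
          ≤⟨ 𝟙-+-≤ (old a b) (isArc y w a b ⊎-dec isArc w y a b) (C⁺? a ×-dec C⁺? b ×-dec a ~? b)
               (λ { ((_ , Cb , _) , inj₁ (_ , refl)) → ¬Cw Cb
                  ; ((Ca , _ , _) , inj₂ (refl , _)) → ¬Cw Ca })
               (λ (Ca , Cb , a~b) → inj₁ Ca , inj₁ Cb , a~b)
               (λ { (inj₁ (refl , refl)) → inj₁ Cy , inj₂ refl , y~w
                  ; (inj₂ (refl , refl)) → inj₂ refl , inj₁ Cy , ~-sym y~w }) ⟩
        𝟙 (C⁺? a ×-dec C⁺? b ×-dec a ~? b) ∎

    extend : Tree x
    extend = record
      { C? = C⁺?
      ; root = inj₁ (root t)
      ; nbr = λ { (inj₁ c) → nbr t c ; (inj₂ refl) → y , ~-sym y~w }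
      ; enough = begin
          2 * size C⁺?              ≡⟨ cong (2 *_) size-extend ⟩
          2 * (size (C? t) + 1)     ≡⟨ *-distribˡ-+ 2 (size (C? t)) 1 ⟩
          2 * size (C? t) + 2       ≤⟨ +-monoˡ-≤ 2 (enough t) ⟩
          arcs (C? t) + 2 + 2       ≤⟨ +-monoˡ-≤ 2 arcs-extend ⟩
          arcs C⁺? + 2              ∎
      }
      where open ≤-Reasoning

  -- A set that is not closed has an edge leaving it and absorbs the far end. Each step adds one
  -- vertex and there are only n, so fuel exceeding n minus the current size cannot run out.
  grow : Symmetric _~_ → ∀ {x} fuel (t : Tree x) → n < size (C? t) + fuel → Σ[ t ∈ Tree x ] Closed t
  grow ~-sym zero t n< = contradiction (subst (n <_) (+-identityʳ _) n<) (≤⇒≯ (size≤n (C? t)))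
  grow ~-sym (suc fuel) t n< with any? (λ y → any? (λ w → C? t y ×-dec ¬? (C? t w) ×-dec y ~? w))
  ... | yes (y , w , Cy , ¬Cw , y~w) = grow ~-sym fuel (extend t Cy ¬Cw y~w ~-sym) (begin-strict
      n                                    <⟨ n< ⟩
      size (C? t) + suc fuel               ≡⟨ +-assoc (size (C? t)) 1 fuel ⟨
      size (C? t) + 1 + fuel               ≡⟨ cong (_+ fuel) (size-extend t Cy ¬Cw y~w ~-sym) ⟨
      size (C? (extend t Cy ¬Cw y~w ~-sym)) + fuel ∎)
      where open ≤-Reasoning
  ... | no none = t , closed
      where
      closed : Closed t
      closed {a} {b} Ca a~b with C? t b
      ... | yes Cb = Cb
      ... | no ¬Cb = contradiction (a , b , Ca , ¬Cb , a~b) none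

  component : Symmetric _~_ → ∀ {x y} → x ~ y → Σ[ t ∈ Tree x ] Closed t
  component ~-sym {x} {y} x~y = grow ~-sym (suc n) singleton (m≤n+m (suc n) _)
    where
    singleton : Tree x
    singleton = record
      { C? = x ≟_
      ; root = refl
      ; nbr = λ { refl → y , x~y }
      ; enough = ≤-trans (≤-reflexive (cong (2 *_) (sum-δ x))) (m≤n+m 2 _)
      }

  2≤size : ∀ {x y} (t : Tree x) → Closed t → x ≢ y → x ~ y → 2 ≤ size (C? t)
  2≤size {x} {y} t closed x≢y x~y = begin
    1 + 1                                         ≡⟨ cong₂ _+_ (sum-δ x) (sum-δ y) ⟨
    ∑[ a < n ] 𝟙 (x ≟ a) + ∑[ a < n ] 𝟙 (y ≟ a)  ≡⟨ ∑-distrib-+ (λ a → 𝟙 (x ≟ a)) (λ a → 𝟙 (y ≟ a)) ⟨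
    ∑[ a < n ] (𝟙 (x ≟ a) + 𝟙 (y ≟ a))
      ≤⟨ sum-mono-≤ (λ a → 𝟙-+-≤ (x ≟ a) (y ≟ a) (C? t a) (λ { (refl , eq) → x≢y (sym eq) })
           (λ { refl → root t }) (λ { refl → closed (root t) x~y })) ⟩
    size (C? t) ∎
    where open ≤-Reasoning

-- Unused edges of a colouring

∑³ : ∀ {n} → (Fin n → Fin n → Fin n → ℕ) → ℕ
∑³ {n} f = ∑[ u < n ] ∑[ v < n ] ∑[ w < n ] f u v w

∑³-mono : ∀ {n} {f g : Fin n → Fin n → Fin n → ℕ} → (∀ u v w → f u v w ≤ g u v w) → ∑³ f ≤ ∑³ g
∑³-mono f≤g = sum-mono-≤ λ u → sum-mono-≤ λ v → sum-mono-≤ λ w → f≤g u v w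

∑³-+ : ∀ {n} (f g : Fin n → Fin n → Fin n → ℕ) → ∑³ (λ u v w → f u v w + g u v w) ≡ ∑³ f + ∑³ g
∑³-+ {n} f g = trans (sum-cong-≗ (λ u → ∑∑-distrib-+ (f u) (g u)))
  (∑-distrib-+ (λ u → ∑[ v < n ] ∑[ w < n ] f u v w) (λ u → ∑[ v < n ] ∑[ w < n ] g u v w))

∑³-swap : ∀ {n} (f : Fin n → Fin n → Fin n → ℕ) → ∑³ (λ u v w → f v u w) ≡ ∑³ f
∑³-swap {n} f = ∑-comm {n} {n} (λ u v → ∑[ w < n ] f v u w)

∑-∑³-comm : ∀ {m n} (f : Fin m → Fin n → Fin n → Fin n → ℕ) →
  ∑[ j < m ] ∑³ (f j) ≡ ∑³ (λ u v w → ∑[ j < m ] f j u v w)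
∑-∑³-comm {m} {n} f =
  trans (∑-comm {m} {n} (λ j u → ∑[ v < n ] ∑[ w < n ] f j u v w)) (sum-cong-≗ λ u →
  trans (∑-comm {m} {n} (λ j v → ∑[ w < n ] f j u v w)) (sum-cong-≗ λ v →
  ∑-comm {m} {n} (λ j w → f j u v w)))

-- Universe levels are free because being non-spanning is witnessed by a `Tree`, which lives in
-- `Set₁`.
exists-or-all : ∀ {a b m} {A : Fin m → Set a} {B : Fin m → Set b} →
  (∀ j → A j ⊎ B j) → (∃ A) ⊎ (∀ j → B j)
exists-or-all {m = zero}  f = inj₂ λ ()
exists-or-all {m = suc m} f with f zero | exists-or-all (f ∘ suc)
... | inj₁ a | _            = inj₁ (zero , a)
... | inj₂ b | inj₁ (j , a) = inj₁ (suc j , a)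
... | inj₂ b | inj₂ bs      = inj₂ λ { zero → b ; (suc j) → bs j }

-- `second v xs` and `penult u xs` are taken on the path u, xs, v.
module _ {A : Set} where

  second : A → List A → A
  second v []      = v
  second v (x ∷ _) = x

  penult : A → List A → A
  penult u []       = u
  penult u (x ∷ xs) = penult x xs

  penult-∈ : ∀ x xs → penult x xs ∈ x ∷ xs
  penult-∈ x []       = here refl
  penult-∈ x (y ∷ xs) = there (penult-∈ y xs)

  module _ {S : A → A → Set} where

    linked-second : ∀ {u v} xs → Linked S (u ∷ xs ++ [ v ]) → S u (second v xs)
    linked-second []       (p ∷ _) = p
    linked-second (x ∷ xs) (p ∷ _) = p

    linked-penult : ∀ {u v} xs → Linked S (u ∷ xs ++ [ v ]) → S (penult u xs) v
    linked-penult []       (p ∷ _)  = p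
    linked-penult (x ∷ xs) (_ ∷ ps) = linked-penult xs ps

    linked-closed : ∀ {C : A → Set} → (∀ {a b} → C a → S a b → C b) →
      ∀ {u v} xs → Linked S (u ∷ xs ++ [ v ]) → C u → C v
    linked-closed cl []       (p ∷ _)  c = cl c p
    linked-closed cl (x ∷ xs) (p ∷ ps) c = linked-closed cl xs ps (cl c p)

  -- Different disjoint paths leave their common start along different edges. The inequality of the
  -- interiors excludes two copies of the single edge, which disjointness alone would allow.
  second-distinct : ∀ {v} xs ys → v ∉ xs → v ∉ ys → xs ≢ ys → Disjoint xs ys →
    second v xs ≢ second v ys
  second-distinct []       []       _  _  ne _ _    = ne refl
  second-distinct []       (y ∷ ys) _  v∉ _  _ refl = v∉ (here refl)
  second-distinct (x ∷ xs) []       v∉ _  _  _ refl = v∉ (here refl)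
  second-distinct (x ∷ xs) (y ∷ ys) _  _  _  d refl = d (here refl , here refl)

  penult-distinct : ∀ {u} xs ys → u ∉ xs → u ∉ ys → xs ≢ ys → Disjoint xs ys →
    penult u xs ≢ penult u ys
  penult-distinct []       []       _  _  ne _ _  = ne refl
  penult-distinct []       (y ∷ ys) _  u∉ _  _ eq = u∉ (subst (_∈ y ∷ ys) (sym eq) (penult-∈ y ys))
  penult-distinct (x ∷ xs) []       u∉ _  _  _ eq = u∉ (subst (_∈ x ∷ xs) eq (penult-∈ x xs))
  penult-distinct (x ∷ xs) (y ∷ ys) _  _  _  d eq =
    d (penult-∈ x xs , subst (_∈ y ∷ ys) (sym eq) (penult-∈ y ys))

  second-∈ : ∀ {v} xs → second v xs ≢ v → second v xs ∈ xs
  second-∈ []       ne = contradiction refl ne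
  second-∈ (x ∷ xs) _  = here refl

  penult-∈-inner : ∀ {u} xs → penult u xs ≢ u → penult u xs ∈ xs
  penult-∈-inner []       ne = contradiction refl ne
  penult-∈-inner (x ∷ xs) _  = penult-∈ x xs

module _ {n : ℕ} (G : Graph n) where
  open Graph G

  deg : Fin n → ℕ
  deg u = ∑[ w < n ] 𝟙 (u ~? w)

  ~⇒≢ : ∀ {u v} → u ~ v → u ≢ v
  ~⇒≢ p refl = ~-irrefl p

  sum-deg : sum deg ≡ e G + e G
  sum-deg = begin
    ∑[ u < n ] ∑[ v < n ] 𝟙 (u ~? v)
      ≡⟨ sum-cong-≗ (λ u → sum-cong-≗ (λ v → orient u v)) ⟩
    ∑[ u < n ] ∑[ v < n ] (𝟙 (arc u v) + 𝟙 (arc v u))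
      ≡⟨ ∑∑-distrib-+ (λ u v → 𝟙 (arc u v)) (λ u v → 𝟙 (arc v u)) ⟩
    ∑[ u < n ] ∑[ v < n ] 𝟙 (arc u v) + ∑[ u < n ] ∑[ v < n ] 𝟙 (arc v u)
      ≡⟨ cong (∑[ u < n ] ∑[ v < n ] 𝟙 (arc u v) +_) (∑-comm {n} {n} (λ u v → 𝟙 (arc v u))) ⟩
    ∑[ u < n ] ∑[ v < n ] 𝟙 (arc u v) + ∑[ u < n ] ∑[ v < n ] 𝟙 (arc u v)
      ≡⟨ cong (λ x → x + x) (length-filter-cartesianProduct {n} {n} _) ⟨
    e G + e G ∎
    where
    open ≡-Reasoning
    arc : ∀ u v → Dec (u Data.Fin.< v × u ~ v)
    arc u v = (u <? v) ×-dec (u ~? v)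
    orient : ∀ u v → 𝟙 (u ~? v) ≡ 𝟙 (arc u v) + 𝟙 (arc v u)
    orient u v with u ~? v
    ... | no u≁v = sym (cong₂ _+_ (𝟙-no ((u <? v) ×-dec no u≁v) (u≁v ∘ proj₂)) (𝟙-no (arc v u) (u≁v ∘ ~-sym ∘ proj₂)))
    ... | yes u~v with Fin.<-cmp u v
    ...   | tri< lt _ ¬gt = sym (cong₂ _+_ (𝟙-yes ((u <? v) ×-dec yes u~v) (lt , u~v)) (𝟙-no (arc v u) (¬gt ∘ proj₁)))
    ...   | tri≈ _ eq _   = contradiction eq (~⇒≢ u~v)
    ...   | tri> ¬lt _ gt = sym (cong₂ _+_ (𝟙-no ((u <? v) ×-dec yes u~v) (¬lt ∘ proj₁)) (𝟙-yes (arc v u) (gt , ~-sym u~v)))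

  module _ {k m : ℕ} (Col : Colouring G m) (MC : MonochromaticConnected G k Col) where
    open Colouring Col
    open Path

    R : Fin m → Fin n → Fin n → Set
    R j u v = Σ[ p ∈ u ~ v ] colour p ≡ j

    colour-irrelevant : ∀ {u v} (p q : u ~ v) → colour p ≡ colour q
    colour-irrelevant p q = trans (colour-edge p (~-sym p)) (colour-edge (~-sym p) q)

    R? : ∀ j → Decidable (R j)
    R? j u v with u ~? v
    ... | no u≁v = no (u≁v ∘ proj₁)
    ... | yes p with colour p ≟ j
    ...   | yes eq = yes (p , eq)
    ...   | no neq = no λ (q , eq) → neq (trans (colour-irrelevant p q) eq)

    R-sym : ∀ {j} → Symmetric (R j)
    R-sym (p , eq) = ~-sym p , trans (colour-edge (~-sym p) p) eq

    R-unique : ∀ {i j u v} → R i u v → R j u v → i ≡ j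
    R-unique (p , refl) (q , refl) = colour-irrelevant p q

    module _ {u v : Fin n} (u≢v : u ≢ v) where

      paths : Fin k → Path G u v
      paths = proj₁ (MC u v u≢v)

      hue : Fin k → Fin m
      hue i = proj₁ (proj₂ (proj₂ (MC u v u≢v)) i)

      hued : ∀ i → Linked (R (hue i)) (vertices (paths i))
      hued i = proj₂ (proj₂ (proj₂ (MC u v u≢v)) i)

      first-nbr last-nbr : Fin k → Fin n
      first-nbr i = second v (inner (paths i))
      last-nbr  i = penult u (inner (paths i))

      first-R : ∀ i → R (hue i) u (first-nbr i)
      first-R i = linked-second (inner (paths i)) (hued i)

      last-R : ∀ i → R (hue i) (last-nbr i) v
      last-R i = linked-penult (inner (paths i)) (hued i)

      -- A monochromatic path takes its colour from its first edge, so a path starting along an edge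
      -- of colour j stays in colour j.
      first-used : ∀ {i j w} → first-nbr i ≡ w → R j u w → Linked (R j) (vertices (paths i))
      first-used {i} refl r = subst (λ c → Linked (R c) _) (R-unique (first-R i) r) (hued i)

      last-used : ∀ {i j w} → last-nbr i ≡ w → R j w v → Linked (R j) (vertices (paths i))
      last-used {i} refl r = subst (λ c → Linked (R c) _) (R-unique (last-R i) r) (hued i)

      u∉inner : ∀ i → u ∉ inner (paths i)
      u∉inner i u∈ = Unique[x∷xs]⇒x∉xs (unique (paths i)) (∈-++⁺ˡ u∈)

      v∉inner : ∀ i → v ∉ inner (paths i)
      v∉inner i v∈ with _ ∷ uniq ← unique (paths i) = last∉ (inner (paths i)) uniq v∈

      first-nbr-injective : Injective _≡_ _≡_ first-nbr
      first-nbr-injective {i} {j} eq with i ≟ j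
      ... | yes i≡j = i≡j
      ... | no i≢j with ne , d ← proj₁ (proj₂ (MC u v u≢v)) i j i≢j =
        contradiction eq (second-distinct _ _ (v∉inner i) (v∉inner j) ne d)

      last-nbr-injective : Injective _≡_ _≡_ last-nbr
      last-nbr-injective {i} {j} eq with i ≟ j
      ... | yes i≡j = i≡j
      ... | no i≢j with ne , d ← proj₁ (proj₂ (MC u v u≢v)) i j i≢j =
        contradiction eq (penult-distinct _ _ (u∉inner i) (u∉inner j) ne d)

      -- Being different from both ends, w is an inner vertex of each of the two paths.
      meet⇒same-path : ∀ {i j w} → w ≢ u → w ≢ v → first-nbr i ≡ w → last-nbr j ≡ w → i ≡ j
      meet⇒same-path {i} {j} w≢u w≢v refl eq with i ≟ j
      ... | yes i≡j = i≡j
      ... | no i≢j with _ , d ← proj₁ (proj₂ (MC u v u≢v)) i j i≢j = ⊥-elim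
        (d (second-∈ (inner (paths i)) w≢v ,
            subst (_∈ inner (paths j)) eq (penult-∈-inner (inner (paths j)) (w≢u ∘ trans (sym eq)))))

    -- The edge uw (respectively vw) is not the first (respectively last) edge of any path chosen
    -- for u, v. The pairs are ordered because the paths chosen for u, v and for v, u are unrelated.
    Unused₁ Unused₂ : Fin n → Fin n → Fin n → Set
    Unused₁ u v w = Σ[ u≢v ∈ u ≢ v ] u ~ w × ¬ (∃[ i ] first-nbr u≢v i ≡ w)
    Unused₂ u v w = Σ[ u≢v ∈ u ≢ v ] v ~ w × ¬ (∃[ i ] last-nbr u≢v i ≡ w)

    unused₁? : ∀ u v w → Dec (Unused₁ u v w)
    unused₁? u v w with u ≟ v
    ... | yes u≡v = no λ (u≢v , _) → u≢v u≡v
    ... | no u≢v with u ~? w ×-dec ¬? (any? (λ i → first-nbr u≢v i ≟ w))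
    ...   | yes p = yes (u≢v , p)
    -- Proofs of `u ≢ v` are definitionally equal, so `p`, which concerns the paths chosen for
    -- another such proof, concerns these same paths.
    ...   | no ¬p = no λ (_ , p) → ¬p p

    unused₂? : ∀ u v w → Dec (Unused₂ u v w)
    unused₂? u v w with u ≟ v
    ... | yes u≡v = no λ (u≢v , _) → u≢v u≡v
    ... | no u≢v with v ~? w ×-dec ¬? (any? (λ i → last-nbr u≢v i ≟ w))
    ...   | yes p = yes (u≢v , p)
    ...   | no ¬p = no λ (_ , p) → ¬p p

    unused-count : ∀ {U : Fin n → Set} (U? : ∀ w → Dec (U w)) {x} (f : Fin k → Fin n) →
      Injective _≡_ _≡_ f → (∀ i → x ~ f i) → (∀ {w} → U w → x ~ w × ¬ (∃[ i ] f i ≡ w)) →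
      ∑[ w < n ] 𝟙 (U? w) + k ≤ deg x
    unused-count U? {x} f inj x~f U⇒ = begin
      ∑[ w < n ] 𝟙 (U? w) + k
        ≤⟨ +-monoʳ-≤ (∑[ w < n ] 𝟙 (U? w)) (size-image f inj) ⟩
      ∑[ w < n ] 𝟙 (U? w) + ∑[ w < n ] 𝟙 (any? (λ i → f i ≟ w))
        ≡⟨ ∑-distrib-+ (λ w → 𝟙 (U? w)) (λ w → 𝟙 (any? (λ i → f i ≟ w))) ⟨
      ∑[ w < n ] (𝟙 (U? w) + 𝟙 (any? (λ i → f i ≟ w)))
        ≤⟨ sum-mono-≤ (λ w → 𝟙-+-≤ (U? w) (any? (λ i → f i ≟ w)) (x ~? w)
             (λ (p , q) → proj₂ (U⇒ p) q) (proj₁ ∘ U⇒) (λ { (i , refl) → x~f i })) ⟩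
      deg x ∎
      where open ≤-Reasoning

    -- The diagonal u = v, where nothing is unused, is padded on both sides.
    unused₁-pair : ∀ u v → ∑[ w < n ] 𝟙 (unused₁? u v w) + (k + 𝟙 (u ≟ v) * deg u)
      ≤ deg u + 𝟙 (u ≟ v) * k
    unused₁-pair u v = bound (u ≟ v)
      where
      open ≤-Reasoning
      bound : (d : Dec (u ≡ v)) →
        ∑[ w < n ] 𝟙 (unused₁? u v w) + (k + 𝟙 d * deg u) ≤ deg u + 𝟙 d * k
      bound (no u≢v) = begin
        ∑[ w < n ] 𝟙 (unused₁? u v w) + (k + 0) ≡⟨ cong (∑[ w < n ] 𝟙 (unused₁? u v w) +_) (+-identityʳ k) ⟩
        ∑[ w < n ] 𝟙 (unused₁? u v w) + k
          ≤⟨ unused-count (unused₁? u v) (first-nbr u≢v) (first-nbr-injective u≢v) (proj₁ ∘ first-R u≢v) proj₂ ⟩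
        deg u         ≡⟨ +-identityʳ (deg u) ⟨
        deg u + 0     ∎
      bound (yes u≡v) = begin
        ∑[ w < n ] 𝟙 (unused₁? u v w) + (k + 1 * deg u)
          ≡⟨ cong (_+ (k + 1 * deg u)) (trans (sum-cong-≗ (λ w → 𝟙-no (unused₁? u v w) λ (u≢v , _) → u≢v u≡v))
               (trans (sum-const n 0) (*-zeroʳ n))) ⟩
        k + 1 * deg u ≡⟨ pad k (deg u) ⟩
        deg u + 1 * k ∎
        where
        pad : ∀ a b → a + 1 * b ≡ b + 1 * a
        pad = solve-∀

    unused₂-pair : ∀ u v → ∑[ w < n ] 𝟙 (unused₂? u v w) + (k + 𝟙 (u ≟ v) * deg u)
      ≤ deg v + 𝟙 (u ≟ v) * k
    unused₂-pair u v = bound (u ≟ v)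
      where
      open ≤-Reasoning
      bound : (d : Dec (u ≡ v)) →
        ∑[ w < n ] 𝟙 (unused₂? u v w) + (k + 𝟙 d * deg u) ≤ deg v + 𝟙 d * k
      bound (no u≢v) = begin
        ∑[ w < n ] 𝟙 (unused₂? u v w) + (k + 0) ≡⟨ cong (∑[ w < n ] 𝟙 (unused₂? u v w) +_) (+-identityʳ k) ⟩
        ∑[ w < n ] 𝟙 (unused₂? u v w) + k
          ≤⟨ unused-count (unused₂? u v) (last-nbr u≢v) (last-nbr-injective u≢v) (~-sym ∘ proj₁ ∘ last-R u≢v) proj₂ ⟩
        deg v         ≡⟨ +-identityʳ (deg v) ⟨
        deg v + 0     ∎
      bound (yes refl) = begin
        ∑[ w < n ] 𝟙 (unused₂? u u w) + (k + 1 * deg u)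
          ≡⟨ cong (_+ (k + 1 * deg u)) (trans (sum-cong-≗ (λ w → 𝟙-no (unused₂? u u w) λ (u≢v , _) → u≢v refl))
               (trans (sum-const n 0) (*-zeroʳ n))) ⟩
        k + 1 * deg u ≡⟨ pad k (deg u) ⟩
        deg u + 1 * k ∎
        where
        pad : ∀ a b → a + 1 * b ≡ b + 1 * a
        pad = solve-∀

    sum-pairs : (U E : Fin n → Fin n → ℕ) →
      (∀ u v → U u v + (k + 𝟙 (u ≟ v) * deg u) ≤ E u v + 𝟙 (u ≟ v) * k) →
      ∑[ u < n ] ∑[ v < n ] E u v ≡ n * sum deg →
      ∑[ u < n ] ∑[ v < n ] U u v + (n * (n * k) + sum deg) ≤ n * sum deg + n * k
    sum-pairs U E bound ∑E = begin
      ∑[ u < n ] ∑[ v < n ] U u v + (n * (n * k) + sum deg)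
        ≡⟨ cong (λ x → ∑[ u < n ] ∑[ v < n ] U u v + x) (sym lhs) ⟩
      ∑[ u < n ] ∑[ v < n ] U u v + ∑[ u < n ] ∑[ v < n ] (k + 𝟙 (u ≟ v) * deg u)
        ≡⟨ ∑∑-distrib-+ U (λ u v → k + 𝟙 (u ≟ v) * deg u) ⟨
      ∑[ u < n ] ∑[ v < n ] (U u v + (k + 𝟙 (u ≟ v) * deg u))
        ≤⟨ sum-mono-≤ (λ u → sum-mono-≤ (λ v → bound u v)) ⟩
      ∑[ u < n ] ∑[ v < n ] (E u v + 𝟙 (u ≟ v) * k)
        ≡⟨ ∑∑-distrib-+ E (λ u v → 𝟙 (u ≟ v) * k) ⟩
      ∑[ u < n ] ∑[ v < n ] E u v + ∑[ u < n ] ∑[ v < n ] (𝟙 (u ≟ v) * k)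
        ≡⟨ cong₂ _+_ ∑E (trans (sum-cong-≗ (λ u → diag u k)) (sum-const n k)) ⟩
      n * sum deg + n * k ∎
      where
      open ≤-Reasoning
      diag : ∀ u x → ∑[ v < n ] (𝟙 (u ≟ v) * x) ≡ x
      diag u x = trans (sym (*-distribʳ-sum x (λ v → 𝟙 (u ≟ v)))) (trans (cong (_* x) (sum-δ u)) (*-identityˡ x))
      lhs : ∑[ u < n ] ∑[ v < n ] (k + 𝟙 (u ≟ v) * deg u) ≡ n * (n * k) + sum deg
      lhs = trans (∑∑-distrib-+ {n} {n} (λ _ _ → k) (λ u v → 𝟙 (u ≟ v) * deg u))
        (cong₂ _+_ (trans (sum-cong-≗ {n} (λ _ → sum-const n k)) (sum-const n (n * k)))
                   (sum-cong-≗ (λ u → diag u (deg u))))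

    T₁ T₂ : ℕ
    T₁ = ∑³ (λ u v w → 𝟙 (unused₁? u v w))
    T₂ = ∑³ (λ u v w → 𝟙 (unused₂? u v w))

    -- This is T₁ ≤ (n - 1)(Σ deg - n k) with all negative terms moved across.
    T₁-bound : T₁ + (n * (n * k) + sum deg) ≤ n * sum deg + n * k
    T₁-bound = sum-pairs _ (λ u _ → deg u) unused₁-pair
      (trans (sum-cong-≗ (λ u → sum-const n (deg u))) (sym (*-distribˡ-sum n deg)))

    T₂-bound : T₂ + (n * (n * k) + sum deg) ≤ n * sum deg + n * k
    T₂-bound = sum-pairs _ (λ _ v → deg v) unused₂-pair (sum-const n (sum deg))

    colDeg : Fin m → Fin n → ℕ
    colDeg j w = ∑[ u < n ] 𝟙 (R? j u w)

    -- What the count of cherries takes from a spanning connected colour: no vertex is missed, and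
    -- there are at least n - 1 edges.
    Spanning : Fin m → Set
    Spanning j = (∀ w → 1 ≤ colDeg j w) × 2 * n ≤ sum (colDeg j) + 2

    open Tree

    NonSpanning : Fin m → Set₁
    NonSpanning j = ∃[ x ] Σ[ t ∈ Tree (R? j) x ]
      Closed (R? j) t × 2 ≤ size (C? t) × (∃[ v ] ¬ C t v)

    -- Every colour occurs on some edge, and the component of that edge alone decides the case; it
    -- has at least two vertices.
    spanning-or-not : ∀ j → Spanning j ⊎ NonSpanning j
    spanning-or-not j with x , y , p , eq ← all-used j
      with t , closed ← component (R? j) R-sym (p , eq)
      with all? (C? t)
    ... | no ¬all = inj₂ (x , t , closed , 2≤size (R? j) t closed (~⇒≢ p) (p , eq) , ¬∀⟶∃¬ n _ (C? t) ¬all)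
    ... | yes all = inj₁ ((λ w → let b , r = nbr t (all w) in
              ≤-trans (≤-reflexive (sym (𝟙-yes (R? j b w) (R-sym r)))) (term≤sum (λ u → 𝟙 (R? j u w)) b)) ,
        (begin
          2 * n                             ≡⟨ cong (2 *_) (*-identityʳ n) ⟨
          2 * (n * 1)                       ≡⟨ cong (2 *_) (sum-const n 1) ⟨
          2 * ∑[ a < n ] 1                  ≡⟨ cong (2 *_) (sum-cong-≗ (λ a → 𝟙-yes (C? t a) (all a))) ⟨
          2 * ∑[ a < n ] 𝟙 (C? t a)         ≤⟨ enough t ⟩
          arcs (R? j) (C? t) + 2
            ≤⟨ +-monoˡ-≤ 2 (sum-mono-≤ (λ a → sum-mono-≤ (λ b →
                 𝟙-mono (C? t a ×-dec C? t b ×-dec R? j a b) (R? j a b) (proj₂ ∘ proj₂)))) ⟩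
          ∑[ a < n ] ∑[ b < n ] 𝟙 (R? j a b) + 2
            ≡⟨ cong (_+ 2) (∑-comm {n} {n} (λ a b → 𝟙 (R? j a b))) ⟩
          sum (colDeg j) + 2                ∎))
      where open ≤-Reasoning

    module Charging (c₀ : Fin m) where

      -- An unused edge uw is charged to its own colour if that is not c₀, and
      -- otherwise to the colour of vw.
      Ch : Fin m → Fin n → Fin n → Fin n → Set
      Ch j u v w = j ≢ c₀ × (R j u w ⊎ (R c₀ u w × R j v w))

      ch? : ∀ j u v w → Dec (Ch j u v w)
      ch? j u v w = ¬? (j ≟ c₀) ×-dec (R? j u w ⊎-dec (R? c₀ u w ×-dec R? j v w))

      -- Since c₀ itself is never charged, the colour of uw decides which clause of `Ch` can apply,
      -- and one edge then fixes the colour.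
      Ch-unique : ∀ {i j u v w} → Ch i u v w → Ch j u v w → i ≡ j
      Ch-unique (_ , inj₁ p) (_ , inj₁ q) = R-unique p q
      Ch-unique (i≢ , inj₁ p) (_ , inj₂ (q , _)) = contradiction (R-unique p q) i≢
      Ch-unique (_ , inj₂ (p , _)) (j≢ , inj₁ q) = contradiction (R-unique q p) j≢
      Ch-unique (_ , inj₂ (_ , p)) (_ , inj₂ (_ , q)) = R-unique p q

      charge₁? : ∀ j u v w → Dec (Unused₁ u v w × Ch j u v w)
      charge₁? j u v w = unused₁? u v w ×-dec ch? j u v w

      charge₂? : ∀ j u v w → Dec (Unused₂ u v w × Ch j v u w)
      charge₂? j u v w = unused₂? u v w ×-dec ch? j v u w

      K : Fin m → ℕ
      K j = ∑³ (λ u v w → 𝟙 (charge₁? j u v w) + 𝟙 (charge₂? j u v w))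

      sum-K≤ : sum K ≤ T₁ + T₂
      sum-K≤ = begin
        sum K ≡⟨ ∑-∑³-comm (λ j u v w → 𝟙 (charge₁? j u v w) + 𝟙 (charge₂? j u v w)) ⟩
        ∑³ (λ u v w → ∑[ j < m ] (𝟙 (charge₁? j u v w) + 𝟙 (charge₂? j u v w)))
          ≤⟨ ∑³-mono (λ u v w → ≤-trans
               (≤-reflexive (∑-distrib-+ (λ j → 𝟙 (charge₁? j u v w)) (λ j → 𝟙 (charge₂? j u v w))))
               (+-mono-≤
                 (sum-exclusive-≤ (λ j → charge₁? j u v w) (unused₁? u v w)
                   (λ p q → Ch-unique (proj₂ p) (proj₂ q)) proj₁)
                 (sum-exclusive-≤ (λ j → charge₂? j u v w) (unused₂? u v w)
                   (λ p q → Ch-unique (proj₂ p) (proj₂ q)) proj₁))) ⟩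
        ∑³ (λ u v w → 𝟙 (unused₁? u v w) + 𝟙 (unused₂? u v w))
          ≡⟨ ∑³-+ (λ u v w → 𝟙 (unused₁? u v w)) (λ u v w → 𝟙 (unused₂? u v w)) ⟩
        T₁ + T₂ ∎
        where open ≤-Reasoning

      -- The factor 4 is made of two arcs for each edge of the component and two orders for each
      -- pair with one vertex inside and one outside.
      charge-nonSpanning : ∀ {j} → j ≢ c₀ → NonSpanning j → 4 * n ≤ K j + 8
      charge-nonSpanning {j} j≢ (x , t , closed , 2≤s , (v₀ , ¬Cv₀)) = begin
        4 * n ≡⟨ cong (4 *_) in+out ⟨
        4 * (s + o) ≤⟨ arith s o (arcs (R? j) (C? t)) 2≤s 1≤o (enough t) ⟩
        2 * (arcs (R? j) (C? t) * o) + 8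
          ≤⟨ +-monoˡ-≤ 8 (*-monoʳ-≤ 2 out-sum) ⟩
        2 * X + 8 ≡⟨ cong (λ y → X + y + 8) (+-identityʳ X) ⟩
        X + X + 8 ≡⟨ cong (λ y → X + y + 8) (∑³-swap (λ u v w → 𝟙 (leaves u v w))) ⟨
        X + ∑³ (λ u v w → 𝟙 (leaves v u w)) + 8
          ≡⟨ cong (_+ 8) (∑³-+ (λ u v w → 𝟙 (leaves u v w)) (λ u v w → 𝟙 (leaves v u w))) ⟨
        ∑³ (λ u v w → 𝟙 (leaves u v w) + 𝟙 (leaves v u w)) + 8
          ≤⟨ +-monoˡ-≤ 8 (∑³-mono λ u v w → +-mono-≤
               (𝟙-mono (leaves u v w) (charge₁? j u v w) unused₁)
               (𝟙-mono (leaves v u w) (charge₂? j u v w) unused₂)) ⟩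
        K j + 8 ∎
        where
        open ≤-Reasoning
        s o : ℕ
        s = size (C? t)
        o = ∑[ v < n ] 𝟙 (¬? (C? t v))

        leaves : ∀ u v w → Dec (C t u × ¬ C t v × R j u w)
        leaves u v w = C? t u ×-dec ¬? (C? t v) ×-dec R? j u w

        X : ℕ
        X = ∑³ (λ u v w → 𝟙 (leaves u v w))

        in+out : s + o ≡ n
        in+out = trans (sym (∑-distrib-+ (λ v → 𝟙 (C? t v)) (λ v → 𝟙 (¬? (C? t v)))))
          (trans (sum-cong-≗ (λ v → 𝟙-¬ (C? t v))) (trans (sum-const n 1) (*-identityʳ n)))

        1≤o : 1 ≤ o
        1≤o = ≤-trans (≤-reflexive (sym (𝟙-yes (¬? (C? t v₀)) ¬Cv₀))) (term≤sum (λ v → 𝟙 (¬? (C? t v))) v₀)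

        out-sum : arcs (R? j) (C? t) * o ≤ X
        out-sum = begin
          arcs (R? j) (C? t) * o
            ≤⟨ *-monoˡ-≤ o (sum-mono-≤ λ u → sum-mono-≤ λ w →
                 𝟙-mono (C? t u ×-dec C? t w ×-dec R? j u w) (C? t u ×-dec R? j u w) λ (p , _ , q) → p , q) ⟩
          (∑[ u < n ] ∑[ w < n ] 𝟙 (C? t u ×-dec R? j u w)) * o
            ≡⟨ *-distribʳ-sum o (λ u → ∑[ w < n ] 𝟙 (C? t u ×-dec R? j u w)) ⟩
          ∑[ u < n ] ((∑[ w < n ] 𝟙 (C? t u ×-dec R? j u w)) * o)
            ≡⟨ sum-cong-≗ (λ u → trans (*-distribˡ-sum (∑[ w < n ] 𝟙 (C? t u ×-dec R? j u w)) (λ v → 𝟙 (¬? (C? t v))))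
                 (sum-cong-≗ (λ v → trans (*-distribʳ-sum (𝟙 (¬? (C? t v))) (λ w → 𝟙 (C? t u ×-dec R? j u w)))
                   (sum-cong-≗ (λ w → split (C? t u) (¬? (C? t v)) (R? j u w)))))) ⟩
          X ∎
          where
          split : ∀ {P Q R : Set} (p : Dec P) (q : Dec Q) (r : Dec R) →
            𝟙 (p ×-dec r) * 𝟙 q ≡ 𝟙 (p ×-dec q ×-dec r)
          split (yes _) (yes _) (yes _) = refl
          split (yes _) (yes _) (no  _) = refl
          split (yes _) (no  _) (yes _) = refl
          split (yes _) (no  _) (no  _) = refl
          split (no  _) _       _       = refl

        unused₁ : ∀ {u v w} → C t u × ¬ C t v × R j u w → Unused₁ u v w × Ch j u v w
        unused₁ {u} {v} {w} (Cu , ¬Cv , r) = (u≢v , proj₁ r , unhit) , j≢ , inj₁ r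
          where
          u≢v : u ≢ v
          u≢v refl = ¬Cv Cu
          unhit : ¬ (∃[ i ] first-nbr u≢v i ≡ w)
          unhit (i , eq) =
            ¬Cv (linked-closed closed (Path.inner (paths u≢v i)) (first-used u≢v eq r) Cu)

        unused₂ : ∀ {u v w} → C t v × ¬ C t u × R j v w → Unused₂ u v w × Ch j v u w
        unused₂ {u} {v} {w} (Cv , ¬Cu , r) = (u≢v , proj₁ r , unhit) , j≢ , inj₁ r
          where
          u≢v : u ≢ v
          u≢v refl = ¬Cu Cv
          unhit : ¬ (∃[ i ] last-nbr u≢v i ≡ w)
          unhit (i , eq) =
            -- By symmetry the complement of a component is closed too, so a path of colour j that
            -- starts outside cannot end inside.
            linked-closed {C = λ a → ¬ C t a} (λ ¬Ca ab Cb → ¬Ca (closed Cb (R-sym ab)))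
              (Path.inner (paths u≢v i)) (last-used u≢v eq (R-sym r)) ¬Cu Cv

        arith : ∀ s o a → 2 ≤ s → 1 ≤ o → 2 * s ≤ a + 2 → 4 * (s + o) ≤ 2 * (a * o) + 8
        -- The claim rests on (s - 1) o - (s + o - 2) = (s - 2)(o - 1) ≥ 0; after the shift of
        -- variables this product is the added `s * o`.
        arith (suc (suc s)) (suc o) a _ _ h = begin
          4 * (2 + s + (1 + o))              ≤⟨ m≤m+n _ (4 * (s * o)) ⟩
          4 * (2 + s + (1 + o)) + 4 * (s * o) ≡⟨ id₁ s o ⟩
          2 * ((2 * s + 2) * suc o) + 8      ≤⟨ +-monoˡ-≤ 8 (*-monoʳ-≤ 2 (*-monoˡ-≤ (suc o) h′)) ⟩
          2 * (a * suc o) + 8                ∎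
          where
          id₁ : ∀ s o → 4 * (2 + s + (1 + o)) + 4 * (s * o) ≡ 2 * ((2 * s + 2) * (1 + o)) + 8
          id₁ = solve-∀
          id₂ : ∀ s → 2 * s + 2 + 2 ≡ 2 * (2 + s)
          id₂ = solve-∀
          h′ : 2 * s + 2 ≤ a
          h′ = +-cancelʳ-≤ 2 _ _ (≤-trans (≤-reflexive (id₂ s)) h)
        arith (suc zero) _ _ (s≤s ()) _ _

      charge-spanning : ∀ {j} → j ≢ c₀ → Spanning c₀ → Spanning j → 4 * n ≤ K j + 8
      charge-spanning {j} j≢ (pos₀ , sum₀) (posⱼ , sumⱼ) = begin
        4 * n ≤⟨ arith n (sum (colDeg c₀)) (sum (colDeg j)) X sum₀ sumⱼ sum≤X ⟩
        X + X + 8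
          ≡⟨ cong (λ y → y + y + 8) X≡ ⟩
        ∑³ (λ u v w → 𝟙 (cherry u v w)) + ∑³ (λ u v w → 𝟙 (cherry u v w)) + 8
          ≡⟨ cong (λ y → ∑³ (λ u v w → 𝟙 (cherry u v w)) + y + 8) (∑³-swap (λ u v w → 𝟙 (cherry u v w))) ⟨
        ∑³ (λ u v w → 𝟙 (cherry u v w)) + ∑³ (λ u v w → 𝟙 (cherry v u w)) + 8
          ≡⟨ cong (_+ 8) (∑³-+ (λ u v w → 𝟙 (cherry u v w)) (λ u v w → 𝟙 (cherry v u w))) ⟨
        ∑³ (λ u v w → 𝟙 (cherry u v w) + 𝟙 (cherry v u w)) + 8
          ≤⟨ +-monoˡ-≤ 8 (∑³-mono λ u v w → ≤-trans
               -- For fixed u, v, w at most one of the two edges has colour c₀, so the two kinds of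
               -- cherry exclude each other and one charged end suffices for both.
               (𝟙-+-≤ (cherry u v w) (cherry v u w) (charge₁? j u v w ⊎-dec charge₂? j u v w)
                  (λ ((p , _) , (_ , q)) → j≢ (R-unique q p)) unused unused′)
               (𝟙-⊎-≤ (charge₁? j u v w) (charge₂? j u v w))) ⟩
        K j + 8 ∎
        where
        open ≤-Reasoning
        cherry : ∀ u v w → Dec (R c₀ u w × R j v w)
        cherry u v w = R? c₀ u w ×-dec R? j v w

        X : ℕ
        X = ∑[ w < n ] (colDeg c₀ w * colDeg j w)

        X≡ : X ≡ ∑³ (λ u v w → 𝟙 (cherry u v w))
        X≡ = trans (sum-cong-≗ λ w →
               trans (*-distribʳ-sum (colDeg j w) (λ u → 𝟙 (R? c₀ u w))) (sum-cong-≗ λ u →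
               trans (*-distribˡ-sum (𝟙 (R? c₀ u w)) (λ v → 𝟙 (R? j v w))) (sum-cong-≗ λ v →
               sym (𝟙-× (R? c₀ u w) (R? j v w)))))
          (trans (∑-comm {n} {n} (λ w u → ∑[ v < n ] 𝟙 (cherry u v w)))
            (sum-cong-≗ λ u → ∑-comm {n} {n} (λ w v → 𝟙 (cherry u v w))))

        sum≤X : sum (colDeg c₀) + sum (colDeg j) ≤ X + n
        sum≤X = begin
          sum (colDeg c₀) + sum (colDeg j)            ≡⟨ ∑-distrib-+ (colDeg c₀) (colDeg j) ⟨
          ∑[ w < n ] (colDeg c₀ w + colDeg j w)       ≤⟨ sum-mono-≤ (λ w → x+y≤xy+1 (pos₀ w) (posⱼ w)) ⟩
          ∑[ w < n ] (colDeg c₀ w * colDeg j w + 1)   ≡⟨ ∑-distrib-+ (λ w → colDeg c₀ w * colDeg j w) (λ _ → 1) ⟩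
          X + ∑[ w < n ] 1                            ≡⟨ cong (X +_) (trans (sum-const n 1) (*-identityʳ n)) ⟩
          X + n                                       ∎
          where
          -- This is (x - 1)(y - 1) ≥ 0, the reason why both colours must be present at every
          -- vertex.
          x+y≤xy+1 : ∀ {x y} → 1 ≤ x → 1 ≤ y → x + y ≤ x * y + 1
          x+y≤xy+1 {suc x} {suc y} _ _ = ≤-trans (m≤m+n _ (x * y)) (≤-reflexive (ident x y))
            where
            ident : ∀ x y → 1 + x + (1 + y) + x * y ≡ (1 + x) * (1 + y) + 1
            ident = solve-∀

        -- If both edges of a two-coloured cherry were used, w would lie inside two of the
        -- paths; these coincide by disjointness, and then both edges have its colour.
        not-both-used : ∀ {i i′ u v w} → i ≢ i′ → R i u w → R i′ v w → (u≢v : u ≢ v) →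
          (∃[ p ] first-nbr u≢v p ≡ w) → (∃[ q ] last-nbr u≢v q ≡ w) → ⊥
        not-both-used i≢i′ r r′ u≢v (p , eq) (q , eq′)
          with refl ← meet⇒same-path u≢v (~⇒≢ (proj₁ r) ∘ sym) (~⇒≢ (proj₁ r′) ∘ sym) eq eq′ =
          i≢i′ (trans (R-unique r (subst (R _ _) eq (first-R u≢v p)))
            (R-unique (R-sym (subst (λ a → R _ a _) eq′ (last-R u≢v p))) r′))

        one-unused : ∀ {i i′ u v w} → i ≢ i′ → R i u w → R i′ v w → Unused₁ u v w ⊎ Unused₂ u v w
        one-unused {u = u} {v} {w} i≢i′ r r′ = by-cases (any? (λ p → first-nbr u≢v p ≟ w))
          where
          u≢v : u ≢ v
          u≢v refl = i≢i′ (R-unique r r′)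
          by-cases : Dec (∃[ p ] first-nbr u≢v p ≡ w) → Unused₁ u v w ⊎ Unused₂ u v w
          by-cases (no unhit) = inj₁ (u≢v , proj₁ r , unhit)
          by-cases (yes hit)  = inj₂ (u≢v , proj₁ r′ , not-both-used i≢i′ r r′ u≢v hit)

        unused : ∀ {u v w} → R c₀ u w × R j v w →
          (Unused₁ u v w × Ch j u v w) ⊎ (Unused₂ u v w × Ch j v u w)
        unused (r₀ , rⱼ) with one-unused (j≢ ∘ sym) r₀ rⱼ
        ... | inj₁ un = inj₁ (un , j≢ , inj₂ (r₀ , rⱼ))
        ... | inj₂ un = inj₂ (un , j≢ , inj₁ rⱼ)

        unused′ : ∀ {u v w} → R c₀ v w × R j u w →
          (Unused₁ u v w × Ch j u v w) ⊎ (Unused₂ u v w × Ch j v u w)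
        unused′ (r₀ , rⱼ) with one-unused j≢ rⱼ r₀
        ... | inj₁ un = inj₁ (un , j≢ , inj₁ rⱼ)
        ... | inj₂ un = inj₂ (un , j≢ , inj₂ (r₀ , rⱼ))

        arith : ∀ n a b x → 2 * n ≤ a + 2 → 2 * n ≤ b + 2 → a + b ≤ x + n → 4 * n ≤ x + x + 8
        arith n a b x ha hb hx = +-cancelʳ-≤ (2 * n) _ _ (begin
          -- The cherries give more than is asked: X ≥ 3n - 4 makes 2X + 8 at least 6n, and the
          -- surplus 2n is dropped here.
          4 * n + 2 * n                          ≤⟨ m≤m+n _ (2 * n) ⟩
          4 * n + 2 * n + 2 * n                  ≡⟨ id₁ n ⟩
          2 * (2 * n + 2 * n)                    ≤⟨ *-monoʳ-≤ 2 (+-mono-≤ ha hb) ⟩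
          2 * (a + 2 + (b + 2))                  ≡⟨ id₂ a b ⟩
          2 * (a + b) + 8                        ≤⟨ +-monoˡ-≤ 8 (*-monoʳ-≤ 2 hx) ⟩
          2 * (x + n) + 8                        ≡⟨ id₃ x n ⟩
          x + x + 8 + 2 * n                      ∎)
          where
          id₁ : ∀ n → 4 * n + 2 * n + 2 * n ≡ 2 * (2 * n + 2 * n)
          id₁ = solve-∀
          id₂ : ∀ a b → 2 * (a + 2 + (b + 2)) ≡ 2 * (a + b) + 8
          id₂ = solve-∀
          id₃ : ∀ x n → 2 * (x + n) + 8 ≡ x + x + 8 + 2 * n
          id₃ = solve-∀

      colours-bound : (∀ {j} → j ≢ c₀ → 4 * n ≤ K j + 8) → m * (4 * (n ∸ 2)) ≤ T₁ + T₂ + 4 * (n ∸ 2)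
      colours-bound charged = begin
        m * N                              ≡⟨ sum-const m N ⟨
        ∑[ j < m ] N                       ≤⟨ sum-mono-≤ (λ j → pointwise j (c₀ ≟ j)) ⟩
        ∑[ j < m ] (K j + 𝟙 (c₀ ≟ j) * N)  ≡⟨ ∑-distrib-+ K (λ j → 𝟙 (c₀ ≟ j) * N) ⟩
        sum K + ∑[ j < m ] (𝟙 (c₀ ≟ j) * N)
          ≡⟨ cong (sum K +_) (trans (sym (*-distribʳ-sum N (λ j → 𝟙 (c₀ ≟ j))))
               (trans (cong (_* N) (sum-δ c₀)) (*-identityˡ N))) ⟩
        sum K + N                          ≤⟨ +-monoˡ-≤ N sum-K≤ ⟩
        T₁ + T₂ + N                        ∎
        where
        open ≤-Reasoning
        N = 4 * (n ∸ 2)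
        pointwise : ∀ j (d : Dec (c₀ ≡ j)) → N ≤ K j + 𝟙 d * N
        pointwise j (yes _) = ≤-trans (≤-reflexive (sym (*-identityˡ N))) (m≤n+m (1 * N) (K j))
        pointwise j (no ne) = begin
          4 * (n ∸ 2)   ≡⟨ *-distribˡ-∸ 4 n 2 ⟩
          4 * n ∸ 8     ≤⟨ ∸-monoˡ-≤ 8 (charged (ne ∘ sym)) ⟩
          K j + 8 ∸ 8   ≡⟨ m+n∸n≡m (K j) 8 ⟩
          K j           ≡⟨ +-identityʳ (K j) ⟨
          K j + 0       ∎

    m-bound : m * (4 * (n ∸ 2)) ≤ T₁ + T₂ + 4 * (n ∸ 2)
    m-bound with exists-or-all spanning-or-not
    ... | inj₁ (c₀ , sp₀) = colours-bound λ {j} j≢ →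
          [ charge-spanning j≢ sp₀ , charge-nonSpanning j≢ ]′ (spanning-or-not j)
      where open Charging c₀
    ... | inj₂ allNon = any-colour m refl
      where
      any-colour : ∀ m′ → m ≡ m′ → m * (4 * (n ∸ 2)) ≤ T₁ + T₂ + 4 * (n ∸ 2)
      any-colour zero    m≡0 = ≤-trans (≤-reflexive (cong (_* (4 * (n ∸ 2))) m≡0)) z≤n
      any-colour (suc _) m≡  = colours-bound λ {j} j≢ → charge-nonSpanning j≢ (allNon j)
        where open Charging (subst Fin (sym m≡) zero)

-- The bounds

open import Data.Integer as ℤ using (+_)
import Data.Integer.DivMod as ℤ
import Data.Integer.Properties as ℤ
import Data.Integer.Tactic.RingSolver as ℤ-Solver

2*nC2+n≡n*n : ∀ n → 2 * (n C 2) + n ≡ n * n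
2*nC2+n≡n*n zero    = refl
2*nC2+n≡n*n (suc n) = begin-equality
  2 * (suc n C 2) + suc n       ≡⟨ cong (λ x → 2 * x + suc n) (nCk+nC[k+1]≡[n+1]C[k+1] n 1) ⟨
  2 * (n C 1 + n C 2) + suc n   ≡⟨ cong (λ x → 2 * (x + n C 2) + suc n) (nC1≡n n) ⟩
  2 * (n + n C 2) + suc n       ≡⟨ regroup n (n C 2) ⟩
  2 * (n C 2) + n + (n + suc n) ≡⟨ cong (_+ (n + suc n)) (2*nC2+n≡n*n n) ⟩
  n * n + (n + suc n)           ≡⟨ square n ⟩
  suc n * suc n                 ∎
  where
  open ≤-Reasoning
  regroup : ∀ n c → 2 * (n + c) + (1 + n) ≡ 2 * c + n + (n + (1 + n))
  regroup = solve-∀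
  square : ∀ n → n * n + (n + (1 + n)) ≡ (1 + n) * (1 + n)
  square = solve-∀

-- With q = 2 + n vertices this is (m - 1)(q - 2) ≤ (q - 1) e(G) - k C(q,2), free of subtraction.
-- The bounds on `T₁` and `T₂` are added to `m-bound`, and the common factor 4 is cancelled.
colour-count : ∀ {n k m} (G : Graph (2 + n)) (Col : Colouring G m) → MonochromaticConnected G k Col →
  m * n + k * ((2 + n) C 2) ≤ n * e G + e G + n
colour-count {n} {k} {m} G Col MC = *-cancelˡ-≤ 4 (+-cancelʳ-≤ (2 * (D + q * k)) _ _ (begin
  4 * (m * n + k * c) + 2 * (D + q * k)
    ≡⟨ shift₁ m n k c D q ⟩
  m * (4 * n) + (2 * D + 2 * ((2 * c + q) * k))
    ≡⟨ cong (λ x → m * (4 * n) + (2 * D + 2 * (x * k))) (2*nC2+n≡n*n q) ⟩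
  m * (4 * n) + (2 * D + 2 * (q * q * k))
    ≤⟨ +-monoˡ-≤ _ (m-bound G Col MC) ⟩
  t₁ + t₂ + 4 * n + (2 * D + 2 * (q * q * k))
    ≡⟨ shift₂ t₁ t₂ n D q k ⟩
  (t₁ + (q * (q * k) + D)) + (t₂ + (q * (q * k) + D)) + 4 * n
    ≤⟨ +-monoˡ-≤ (4 * n) (+-mono-≤ (T₁-bound G Col MC) (T₂-bound G Col MC)) ⟩
  (q * D + q * k) + (q * D + q * k) + 4 * n
    ≡⟨ cong (λ d → (q * d + q * k) + (q * d + q * k) + 4 * n) (sum-deg G) ⟩
  (q * (ε + ε) + q * k) + (q * (ε + ε) + q * k) + 4 * n
    ≡⟨ shift₃ n ε k ⟩
  4 * (n * ε + ε + n) + 2 * (ε + ε + q * k)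
    ≡⟨ cong (λ d → 4 * (n * ε + ε + n) + 2 * (d + q * k)) (sum-deg G) ⟨
  4 * (n * ε + ε + n) + 2 * (D + q * k) ∎))
  where
  open ≤-Reasoning
  q = 2 + n
  c = q C 2
  D = sum (deg G)
  ε = e G
  t₁ = T₁ G Col MC
  t₂ = T₂ G Col MC
  shift₁ : ∀ m n k c D q →
    4 * (m * n + k * c) + 2 * (D + q * k) ≡ m * (4 * n) + (2 * D + 2 * ((2 * c + q) * k))
  shift₁ = solve-∀
  shift₂ : ∀ t₁ t₂ n D q k → t₁ + t₂ + 4 * n + (2 * D + 2 * (q * q * k))
    ≡ (t₁ + (q * (q * k) + D)) + (t₂ + (q * (q * k) + D)) + 4 * n
  shift₂ = solve-∀
  shift₃ : ∀ n ε k → ((2 + n) * (ε + ε) + (2 + n) * k) + ((2 + n) * (ε + ε) + (2 + n) * k) + 4 * n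
    ≡ 4 * (n * ε + ε + n) + 2 * (ε + ε + (2 + n) * k)
  shift₃ = solve-∀

-- The ceiling of x/d is minus the floor q of -x/d, and -y d ≤ -x < (q + 1) d forces -y ≤ q.
ceiling-≤ : ∀ x y d → x ℤ.≤ y ℤ.* + suc d → ceiling (x / suc d) ℤ.≤ y
ceiling-≤ x y d x≤yd = begin
  ℤ.- ((ℤ.- x) ℤ./ + suc d) ≡⟨ cong ℤ.-_ (ℤ.div-pos-is-/ℕ (ℤ.- x) (suc d)) ⟩
  ℤ.- q                     ≤⟨ ℤ.neg-mono-≤ -y≤q ⟩
  ℤ.- (ℤ.- y)               ≡⟨ ℤ.neg-involutive y ⟩
  y                         ∎
  where
  open ℤ.≤-Reasoning
  q = (ℤ.- x) ℤ./ℕ suc d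
  -y≤q : ℤ.- y ℤ.≤ q
  -y≤q = subst (ℤ.- y ℤ.≤_) (ℤ.pred-suc q) (ℤ.i<j⇒i≤pred[j] (ℤ.*-cancelʳ-<-nonNeg {j = ℤ.suc q} (+ suc d) (begin-strict
    ℤ.- y ℤ.* + suc d      ≡⟨ ℤ.neg-distribˡ-* y (+ suc d) ⟨
    ℤ.- (y ℤ.* + suc d)    ≤⟨ ℤ.neg-mono-≤ x≤yd ⟩
    ℤ.- x                  <⟨ ℤ.n<s[n/ℕd]*d (ℤ.- x) (suc d) ⟩
    ℤ.suc q ℤ.* + suc d    ∎)))

ceiling-bound : ∀ m ε c d → m * suc d + c ≤ suc d * ε + ε + suc d →
  + m ℤ.≤ + ε ℤ.- ceiling ((+ c ℤ.- + ε) / suc d) ℤ.+ + 1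
ceiling-bound m ε c d h = begin
  + m                                   ≡⟨ id₁ (+ m) (+ ε) ⟩
  + ε ℤ.- (+ ε ℤ.- + m ℤ.+ + 1) ℤ.+ + 1
    ≤⟨ ℤ.+-monoˡ-≤ (+ 1) (ℤ.+-monoʳ-≤ (+ ε) (ℤ.neg-mono-≤ (ceiling-≤ _ (+ ε ℤ.- + m ℤ.+ + 1) d bound))) ⟩
  + ε ℤ.- ceiling ((+ c ℤ.- + ε) / suc d) ℤ.+ + 1 ∎
  where
  open ℤ.≤-Reasoning
  id₁ : ∀ m ε → m ≡ ε ℤ.- (ε ℤ.- m ℤ.+ + 1) ℤ.+ + 1
  id₁ = ℤ-Solver.solve-∀
  id₂ : ∀ m ε c d → c ℤ.- ε ≡ m ℤ.* d ℤ.+ c ℤ.- (m ℤ.* d ℤ.+ ε)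
  id₂ = ℤ-Solver.solve-∀
  id₃ : ∀ m ε d → d ℤ.* ε ℤ.+ ε ℤ.+ d ℤ.- (m ℤ.* d ℤ.+ ε) ≡ (ε ℤ.- m ℤ.+ + 1) ℤ.* d
  id₃ = ℤ-Solver.solve-∀
  cast₁ : + (m * suc d + c) ≡ + m ℤ.* + suc d ℤ.+ + c
  cast₁ = cong (ℤ._+ + c) (ℤ.pos-* m (suc d))
  cast₂ : + (suc d * ε + ε + suc d) ≡ + suc d ℤ.* + ε ℤ.+ + ε ℤ.+ + suc d
  cast₂ = cong (λ x → x ℤ.+ + ε ℤ.+ + suc d) (ℤ.pos-* (suc d) ε)
  bound : + c ℤ.- + ε ℤ.≤ (+ ε ℤ.- + m ℤ.+ + 1) ℤ.* + suc d
  bound = begin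
    + c ℤ.- + ε ≡⟨ id₂ (+ m) (+ ε) (+ c) (+ suc d) ⟩
    + m ℤ.* + suc d ℤ.+ + c ℤ.- (+ m ℤ.* + suc d ℤ.+ + ε)
      ≡⟨ cong (ℤ._- (+ m ℤ.* + suc d ℤ.+ + ε)) cast₁ ⟨
    + (m * suc d + c) ℤ.- (+ m ℤ.* + suc d ℤ.+ + ε)
      ≤⟨ ℤ.+-monoˡ-≤ (ℤ.- (+ m ℤ.* + suc d ℤ.+ + ε)) (ℤ.+≤+ h) ⟩
    + (suc d * ε + ε + suc d) ℤ.- (+ m ℤ.* + suc d ℤ.+ + ε)
      ≡⟨ cong (ℤ._- (+ m ℤ.* + suc d ℤ.+ + ε)) cast₂ ⟩
    + suc d ℤ.* + ε ℤ.+ + ε ℤ.+ + suc d ℤ.- (+ m ℤ.* + suc d ℤ.+ + ε)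
      ≡⟨ id₃ (+ m) (+ ε) (+ suc d) ⟩
    (+ ε ℤ.- + m ℤ.+ + 1) ℤ.* + suc d ∎

2*⌈n/2⌉≤1+n : ∀ n → 2 * ⌈ n /2⌉ ≤ 1 + n
2*⌈n/2⌉≤1+n zero          = z≤n
2*⌈n/2⌉≤1+n (suc zero)    = ≤-refl
2*⌈n/2⌉≤1+n (suc (suc n)) = begin
  2 * suc ⌈ n /2⌉     ≡⟨ *-suc 2 ⌈ n /2⌉ ⟩
  2 + 2 * ⌈ n /2⌉     ≤⟨ +-monoʳ-≤ 2 (2*⌈n/2⌉≤1+n n) ⟩
  2 + (1 + n)         ∎
  where open ≤-Reasoning

-- Doubling the count and using 2ε ≤ k(2 + n) + 1 leaves 2(m - 1) n ≤ n + 1. The rounding of ε thus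
-- spares only n ≤ 1 when there are two or more colours, and those cases are checked by hand.
at-most-one : ∀ n k m ε → 2 ≤ k → k < 2 + n → ε ≡ ⌈ k * (2 + n) /2⌉ →
  m * n + k * ((2 + n) C 2) ≤ n * ε + ε + n → m ≤ 1
at-most-one n k zero ε _ _ _ _ = z≤n
at-most-one n k (suc zero) ε _ _ _ _ = ≤-refl
at-most-one n k (suc (suc m)) ε 2≤k k<n ε≡ h = contradiction h (small n k m ε 2≤k k<n ε≡ n≤1)
  where
  open ≤-Reasoning
  c = (2 + n) C 2
  n≤1 : n ≤ 1
  n≤1 = +-cancelʳ-≤ (n + (2 * c + (2 + n)) * k + 2 * n) n 1 (begin
    n + (n + (2 * c + (2 + n)) * k + 2 * n)          ≤⟨ m≤m+n _ (2 * (m * n)) ⟩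
    n + (n + (2 * c + (2 + n)) * k + 2 * n) + 2 * (m * n)
      ≡⟨ id₁ n k m c ⟩
    2 * ((2 + m) * n + k * c) + (2 + n) * k          ≤⟨ +-monoˡ-≤ ((2 + n) * k) (*-monoʳ-≤ 2 h) ⟩
    2 * (n * ε + ε + n) + (2 + n) * k                ≡⟨ id₂ n ε k ⟩
    (1 + n) * (2 * ε) + 2 * n + (2 + n) * k
      ≤⟨ +-monoˡ-≤ ((2 + n) * k) (+-monoˡ-≤ (2 * n) (*-monoʳ-≤ (1 + n)
           (≤-trans (≤-reflexive (cong (2 *_) ε≡)) (2*⌈n/2⌉≤1+n (k * (2 + n)))))) ⟩
    (1 + n) * (1 + k * (2 + n)) + 2 * n + (2 + n) * k
      ≡⟨ id₃ n k ⟩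
    1 + (n + (2 + n) * (2 + n) * k + 2 * n)
      ≡⟨ cong (λ x → 1 + (n + x * k + 2 * n)) (2*nC2+n≡n*n (2 + n)) ⟨
    1 + (n + (2 * c + (2 + n)) * k + 2 * n) ∎)
    where
    id₁ : ∀ n k m c → n + (n + (2 * c + (2 + n)) * k + 2 * n) + 2 * (m * n)
      ≡ 2 * ((2 + m) * n + k * c) + (2 + n) * k
    id₁ = solve-∀
    id₂ : ∀ n ε k → 2 * (n * ε + ε + n) + (2 + n) * k ≡ (1 + n) * (2 * ε) + 2 * n + (2 + n) * k
    id₂ = solve-∀
    id₃ : ∀ n k → (1 + n) * (1 + k * (2 + n)) + 2 * n + (2 + n) * k
      ≡ 1 + (n + (2 + n) * (2 + n) * k + 2 * n)
    id₃ = solve-∀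
  small : ∀ n k m ε → 2 ≤ k → k < 2 + n → ε ≡ ⌈ k * (2 + n) /2⌉ → n ≤ 1 →
    (2 + m) * n + k * ((2 + n) C 2) ≰ n * ε + ε + n
  small 0 k _ _ 2≤k k<n _ _ _ = contradiction 2≤k (<⇒≱ k<n)
  small 1 (suc zero) _ _ (s≤s ())
  -- The triangle with k = 2: here ε = 3 is exact, and the count would say 8 + m ≤ 7.
  small 1 (suc (suc zero)) m _ _ _ refl _ h = contradiction h (<⇒≱ {7} {2 + m * 1 + 6} (+-monoˡ-≤ 6 (m≤m+n 2 (m * 1))))
  small 1 (suc (suc (suc k))) _ _ _ k<n _ _ _ = contradiction k<n λ { (s≤s (s≤s (s≤s ()))) }
  small (suc (suc _)) _ _ _ _ _ _ (s≤s ()) _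

one-colour : ∀ {n k} (G : Graph (2 + n)) → KConnected G (suc k) →
  Σ[ Col ∈ Colouring G 1 ] MonochromaticConnected G (suc k) Col
one-colour G conn = Col , λ u v u≢v →
  let Ps , disj = KConnected⇒disjointPaths G conn u v u≢v
  in Ps , disj , λ i → zero , Linked.map (λ p → p , refl) (Path.linked (Ps i))
  where
  -- The single colour has to occur, so an edge is needed; the first edge of this path serves.
  P₀₁ : Path G zero (suc zero)
  P₀₁ = proj₁ (KConnected⇒disjointPaths G conn zero (suc zero) λ ()) zero
  Col : Colouring G 1
  Col = record
    { colour = λ _ → zero
    ; colour-edge = λ _ _ → refl
    ; all-used = λ { zero → zero , _ , linked-second (Path.inner P₀₁) (Path.linked P₀₁) , refl }
    }

theorem2p8 : (n k : ℕ) (2≤k : 2 ≤ k) (k<n : k < n) (G : Graph n) → KConnected G k →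
    (∀ m → IsMc G k m →
    + m ℤ.≤ + (e G) ℤ.- ceiling (_/_ (+ (k * (n C 2)) ℤ.- + (e G)) (n ∸ 2) {{n∸2-nonZero 2≤k k<n}}) ℤ.+ + 1)
    × (e G ≡ ⌈ k * n /2⌉ → IsMc G k 1)
-- From 2 ≤ k < n follows n ≥ 3, so the divisor n - 2 is a successor.
theorem2p8 (suc (suc (suc n))) k@(suc _) 2≤k k<n G conn =
  (λ m ((Col , MC) , _) → ceiling-bound m (e G) (k * ((3 + n) C 2)) n (colour-count G Col MC)) ,
  λ e≡ → one-colour G conn ,
    λ m Col MC → at-most-one (suc n) k m (e G) 2≤k k<n e≡ (colour-count G Col MC)
theorem2p8 (suc (suc zero)) k 2≤k k<n = contradiction 2≤k (<⇒≱ k<n)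
theorem2p8 (suc zero) k 2≤k (s≤s z≤n) = contradiction 2≤k λ ()
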